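{- Let $n\ge 2$, let $C_3$ be the cycle on $3$ vertices and $P_n$ the path on $n$ vertices. Then $\mathrm{mr}_+(C_3\,\Box\,P_n)=3n-3$, i.e. $\mathrm{mr}_+^{\mathbb{R}}(C_3\,\Box\,P_n)=\mathrm{mr}_+^{\mathbb{C}}(C_3\,\Box\,P_n)=3n-3$.
   Context: For an $N\times N$ Hermitian matrix $A$, $\mathcal{G}(A)$ is the simple graph on $\{1,\dots,N\}$ in which distinct $i,j$ are adjacent iff $A_{ij}\ne0$ (the diagonal is unconstrained). For a simple graph $G$ on $N$ vertices, $\mathrm{mr}_+^{\mathbb{R}}(G)$ (resp. $\mathrm{mr}_+^{\mathbb{C}}(G)$) is the minimum rank of a real symmetric (resp. complex Hermitian) positive semidefinite $N\times N$ matrix $B$ with $\mathcal{G}(B)=G$. If the two numbers are equal, the common value is denoted $\mathrm{mr}_+(G)$. The Cartesian product $G_1\,\Box\,G_2$ of $G_1=(V_1,E_1)$ and $G_2=(V_2,E_2)$ has vertex set $V_1\times V_2$, with $(u,v)$ adjacent to $(u',v')$ iff (1) $u=u'$ and $\{v,v'\}\in E_2$, or (2) $v=v'$ and $\{u,u'\}\in E_1$. -}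

module Defs where

open import Algebra.Bundles using (CommutativeRing)
open import Algebra.Definitions.RawMonoid using (sum)
open import Data.Fin using (Fin; toℕ)
open import Data.Nat as ℕ using (ℕ; suc; NonZero)
open import Data.Nat.DivMod using (_%_)
import Data.Nat.Properties as ℕ
open import Data.Product using (Σ; ∃; ∃-syntax; _×_; _,_; proj₁; proj₂)
open import Data.Rational as ℚ using (ℚ; 0ℚ; 1ℚ; ½; ∣_∣)
import Data.Rational.Properties as ℚ
open import Data.Rational.Solver using (module +-*-Solver)
open import Data.Sum using (_⊎_; inj₁; inj₂)
import Data.Sum as Sum
open import Data.Vec.Functional using (Vector)
open import Function using (_∘_; id)
open import Function.Bundles using (_↔_; _⇔_; module Inverse)
open import Level using (0ℓ)
open import Relation.Binary.PropositionalEquality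
  using (_≡_; _≢_; refl; sym; trans; cong; subst)
open import Relation.Nullary using (¬_)

------------------------------------------------------------------------
-- Estimates in ℚ

private
  half>0 : ∀ {ε} → 0ℚ ℚ.< ε → 0ℚ ℚ.< ½ ℚ.* ε
  half>0 {ε} ε>0 =
    subst (ℚ._< ½ ℚ.* ε) (ℚ.*-zeroʳ ½) (ℚ.*-monoʳ-<-pos ½ ε>0)

  half+half : ∀ ε → ½ ℚ.* ε ℚ.+ ½ ℚ.* ε ≡ ε
  half+half ε = trans (sym (ℚ.*-distribʳ-+ ε ½ ½)) (ℚ.*-identityˡ ε)

  ∣+∣< : ∀ {ε} a b → ∣ a ∣ ℚ.< ½ ℚ.* ε → ∣ b ∣ ℚ.< ½ ℚ.* ε → ∣ a ℚ.+ b ∣ ℚ.< ε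
  ∣+∣< {ε} a b a< b< = ℚ.≤-<-trans (ℚ.∣p+q∣≤∣p∣+∣q∣ a b)
    (subst (∣ a ∣ ℚ.+ ∣ b ∣ ℚ.<_) (half+half ε) (ℚ.+-mono-< a< b<))

  ∣-∣-comm : ∀ p q → ∣ p ℚ.- q ∣ ≡ ∣ q ℚ.- p ∣
  ∣-∣-comm p q = trans (sym (ℚ.∣-p∣≡∣p∣ (p ℚ.- q)))
    (cong ∣_∣ (solve 2 (λ p q → :- (p :- q) := q :- p) refl p q))
    where open +-*-Solver

  ∣p-p∣< : ∀ {p q ε} → 0ℚ ℚ.< ε → p ≡ q → ∣ p ℚ.- q ∣ ℚ.< ε
  ∣p-p∣< {p} {ε = ε} ε>0 refl = subst (λ z → ∣ z ∣ ℚ.< ε) (sym (ℚ.+-inverseʳ p)) ε>0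

  -- If ∣a∣ ≤ B and ∣d∣ < shrink B ε then ∣a * d∣ < ε.
  shrink : ∀ B → .{{ℚ.Positive B}} → ℚ → ℚ
  shrink B ε = (ℚ.1/ B) {{ℚ.pos⇒nonZero B}} ℚ.* ε

  shrink>0 : ∀ B .{{_ : ℚ.Positive B}} {ε} → 0ℚ ℚ.< ε → 0ℚ ℚ.< shrink B ε
  shrink>0 B {ε} ε>0 = subst (ℚ._< shrink B ε) (ℚ.*-zeroʳ B⁻¹)
    (ℚ.*-monoʳ-<-pos B⁻¹ {{ℚ.1/pos⇒pos B}} ε>0)
    where B⁻¹ = (ℚ.1/ B) {{ℚ.pos⇒nonZero B}}

  ∣*∣< : ∀ B .{{_ : ℚ.Positive B}} {ε} a d →
         ∣ a ∣ ℚ.≤ B → ∣ d ∣ ℚ.< shrink B ε → ∣ a ℚ.* d ∣ ℚ.< ε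
  ∣*∣< B {ε} a d a≤B d< = begin-strict
    ∣ a ℚ.* d ∣                ≡⟨ ℚ.∣p*q∣≡∣p∣*∣q∣ a d ⟩
    ∣ a ∣ ℚ.* ∣ d ∣            ≤⟨ ℚ.*-monoʳ-≤-nonNeg ∣ d ∣ {{ℚ.∣-∣-nonNeg d}} a≤B ⟩
    B ℚ.* ∣ d ∣                <⟨ ℚ.*-monoʳ-<-pos B d< ⟩
    B ℚ.* shrink B ε           ≡⟨ sym (ℚ.*-assoc B _ ε) ⟩
    (B ℚ.* (ℚ.1/ B) {{nz}}) ℚ.* ε  ≡⟨ cong (ℚ._* ε) (ℚ.*-inverseʳ B {{nz}}) ⟩
    1ℚ ℚ.* ε                   ≡⟨ ℚ.*-identityˡ ε ⟩
    ε                          ∎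
    where open ℚ.≤-Reasoning
          nz = ℚ.pos⇒nonZero B

  *-difference : ∀ a b c d → a ℚ.* b ℚ.- c ℚ.* d ≡ a ℚ.* (b ℚ.- d) ℚ.+ d ℚ.* (a ℚ.- c)
  *-difference = solve 4
    (λ a b c d → a :* b :- c :* d := a :* (b :- d) :+ d :* (a :- c)) refl
    where open +-*-Solver

  +-difference : ∀ a b c d → (a ℚ.+ b) ℚ.- (c ℚ.+ d) ≡ (a ℚ.- c) ℚ.+ (b ℚ.- d)
  +-difference = solve 4
    (λ a b c d → (a :+ b) :- (c :+ d) := (a :- c) :+ (b :- d)) refl
    where open +-*-Solver

  neg-difference : ∀ p q → ∣ p ℚ.- q ∣ ≡ ∣ (ℚ.- p) ℚ.- (ℚ.- q) ∣
  neg-difference p q = trans (∣-∣-comm p q)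
    (cong ∣_∣ (solve 2 (λ p q → q :- p := (:- p) :- (:- q)) refl p q))
    where open +-*-Solver

------------------------------------------------------------------------
-- Real numbers

Eventually : (ℕ → Set) → Set
Eventually P = ∃[ N ] ∀ n → N ℕ.≤ n → P n

private
  both : ∀ {P Q : ℕ → Set} → Eventually P → Eventually Q → Eventually (λ n → P n × Q n)
  both (M , p) (N , q) = M ℕ.⊔ N , λ n h →
    p n (ℕ.≤-trans (ℕ.m≤m⊔n M N) h) , q n (ℕ.≤-trans (ℕ.m≤n⊔m M N) h)

IsCauchy : (ℕ → ℚ) → Set
IsCauchy x = ∀ ε → 0ℚ ℚ.< ε →
  ∃[ N ] ∀ m n → N ℕ.≤ m → N ℕ.≤ n → ∣ x m ℚ.- x n ∣ ℚ.< ε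

-- Reals are Cauchy sequences of rationals; the quotient by null sequences
-- is replaced by the setoid equality _≈ᴿ_.
record ℝ : Set where
  constructor mkℝ
  field
    seq      : ℕ → ℚ
    isCauchy : IsCauchy seq

open ℝ public

infix 4 _≈ᴿ_ _≤ᴿ_

record _≈ᴿ_ (x y : ℝ) : Set where
  constructor mk≈
  field close : ∀ ε → 0ℚ ℚ.< ε → Eventually (λ n → ∣ seq x n ℚ.- seq y n ∣ ℚ.< ε)

open _≈ᴿ_ public

record _≤ᴿ_ (x y : ℝ) : Set where
  constructor mk≤
  field below : ∀ ε → 0ℚ ℚ.< ε → Eventually (λ n → seq x n ℚ.< seq y n ℚ.+ ε)

open _≤ᴿ_ public

pointwise : ∀ {x y} → (∀ n → seq x n ≡ seq y n) → x ≈ᴿ y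
pointwise eq = mk≈ λ ε ε>0 → 0 , λ n _ → ∣p-p∣< ε>0 (eq n)

≈ᴿ-refl : ∀ {x} → x ≈ᴿ x
≈ᴿ-refl = pointwise λ _ → refl

≈ᴿ-sym : ∀ {x y} → x ≈ᴿ y → y ≈ᴿ x
≈ᴿ-sym {x} {y} p = mk≈ λ ε ε>0 → let N , h = close p ε ε>0 in
  N , λ n N≤n → subst (ℚ._< ε) (∣-∣-comm (seq x n) (seq y n)) (h n N≤n)

≈ᴿ-trans : ∀ {x y z} → x ≈ᴿ y → y ≈ᴿ z → x ≈ᴿ z
≈ᴿ-trans {x} {y} {z} p q = mk≈ λ ε ε>0 →
  let N , h = both (close p _ (half>0 ε>0)) (close q _ (half>0 ε>0)) in
  N , λ n N≤n → subst (λ t → ∣ t ∣ ℚ.< ε) (telescope (seq x n) (seq y n) (seq z n))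
    (∣+∣< (seq x n ℚ.- seq y n) (seq y n ℚ.- seq z n) (proj₁ (h n N≤n)) (proj₂ (h n N≤n)))
  where
  open +-*-Solver
  telescope : ∀ a b c → (a ℚ.- b) ℚ.+ (b ℚ.- c) ≡ a ℚ.- c
  telescope = solve 3 (λ a b c → (a :- b) :+ (b :- c) := a :- c) refl

private
  record Bound (x : ℕ → ℚ) : Set where
    field
      B       : ℚ
      {{B>0}} : ℚ.Positive B
      from    : ℕ
      bounded : ∀ n → from ℕ.≤ n → ∣ x n ∣ ℚ.≤ B

  bound : ∀ x → Bound (seq x)
  bound x = record
    { B = B ; B>0 = ℚ.positive B>0 ; from = N
    ; bounded = λ n N≤n → ℚ.<⇒≤ (begin-strict
        ∣ s n ∣                        ≡⟨ cong ∣_∣ (shift (s n) (s N)) ⟩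
        ∣ (s n ℚ.- s N) ℚ.+ s N ∣      ≤⟨ ℚ.∣p+q∣≤∣p∣+∣q∣ (s n ℚ.- s N) (s N) ⟩
        ∣ s n ℚ.- s N ∣ ℚ.+ ∣ s N ∣    <⟨ ℚ.+-monoˡ-< ∣ s N ∣ (h n N N≤n ℕ.≤-refl) ⟩
        B                              ∎) }
    where
    open ℚ.≤-Reasoning
    open +-*-Solver using (solve; _:=_; _:+_; _:-_)
    s = seq x
    1>0 : 0ℚ ℚ.< 1ℚ
    1>0 = ℚ.positive⁻¹ 1ℚ
    N = proj₁ (isCauchy x 1ℚ 1>0)
    h = proj₂ (isCauchy x 1ℚ 1>0)
    B = 1ℚ ℚ.+ ∣ s N ∣
    B>0 : 0ℚ ℚ.< B
    B>0 = ℚ.+-mono-<-≤ 1>0 (ℚ.nonNegative⁻¹ ∣ s N ∣ {{ℚ.∣-∣-nonNeg (s N)}})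
    shift : ∀ a b → a ≡ (a ℚ.- b) ℚ.+ b
    shift = solve 2 (λ a b → a := (a :- b) :+ b) refl

  ⊔-split : ∀ {a b c d n} → (a ℕ.⊔ b) ℕ.⊔ (c ℕ.⊔ d) ℕ.≤ n →
            (a ℕ.≤ n × b ℕ.≤ n) × (c ℕ.≤ n × d ℕ.≤ n)
  ⊔-split {a} {b} {c} {d} h =
    (ℕ.m⊔n≤o⇒m≤o a b ab , ℕ.m⊔n≤o⇒n≤o a b ab) , (ℕ.m⊔n≤o⇒m≤o c d cd , ℕ.m⊔n≤o⇒n≤o c d cd)
    where ab = ℕ.m⊔n≤o⇒m≤o (a ℕ.⊔ b) (c ℕ.⊔ d) h
          cd = ℕ.m⊔n≤o⇒n≤o (a ℕ.⊔ b) (c ℕ.⊔ d) h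

fromℚ : ℚ → ℝ
fromℚ q = mkℝ (λ _ → q) λ ε ε>0 → 0 , λ _ _ _ _ → ∣p-p∣< ε>0 (refl {x = q})

0ᴿ 1ᴿ : ℝ
0ᴿ = fromℚ 0ℚ
1ᴿ = fromℚ 1ℚ

abstract
  +-isCauchy : ∀ x y → IsCauchy (λ n → seq x n ℚ.+ seq y n)
  +-isCauchy x y ε ε>0 =
    let M , p = isCauchy x _ (half>0 ε>0)
        N , q = isCauchy y _ (half>0 ε>0)
    in M ℕ.⊔ N , λ m n hm hn →
      subst (λ t → ∣ t ∣ ℚ.< ε) (sym (+-difference (seq x m) (seq y m) (seq x n) (seq y n)))
        (∣+∣< (seq x m ℚ.- seq x n) (seq y m ℚ.- seq y n)
          (p m n (ℕ.m⊔n≤o⇒m≤o M N hm) (ℕ.m⊔n≤o⇒m≤o M N hn))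
          (q m n (ℕ.m⊔n≤o⇒n≤o M N hm) (ℕ.m⊔n≤o⇒n≤o M N hn)))

  neg-isCauchy : ∀ x → IsCauchy (λ n → ℚ.- seq x n)
  neg-isCauchy x ε ε>0 =
    let N , p = isCauchy x ε ε>0 in
    N , λ m n hm hn → subst (ℚ._< ε) (neg-difference (seq x m) (seq x n)) (p m n hm hn)

  *-isCauchy : ∀ x y → IsCauchy (λ n → seq x n ℚ.* seq y n)
  *-isCauchy x y ε ε>0 =
    let N , p = isCauchy x _ (shrink>0 Y.B {{Y.B>0}} (half>0 ε>0))
        M , q = isCauchy y _ (shrink>0 X.B {{X.B>0}} (half>0 ε>0))
    in (X.from ℕ.⊔ Y.from) ℕ.⊔ (N ℕ.⊔ M) , λ m n hm hn →
      let (mX , _) , (mN , mM) = ⊔-split {X.from} {Y.from} {N} {M} hm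
          (_ , nY) , (nN , nM) = ⊔-split {X.from} {Y.from} {N} {M} hn
      in subst (λ t → ∣ t ∣ ℚ.< ε) (sym (*-difference (seq x m) (seq y m) (seq x n) (seq y n)))
           (∣+∣< (seq x m ℚ.* (seq y m ℚ.- seq y n)) (seq y n ℚ.* (seq x m ℚ.- seq x n))
             (∣*∣< X.B {{X.B>0}} (seq x m) (seq y m ℚ.- seq y n) (X.bounded m mX) (q m n mM nM))
             (∣*∣< Y.B {{Y.B>0}} (seq y n) (seq x m ℚ.- seq x n) (Y.bounded n nY) (p m n mN nN)))
    where
    module X = Bound (bound x)
    module Y = Bound (bound y)

infix  8 -ᴿ_
infixl 7 _*ᴿ_
infixl 6 _+ᴿ_ _-ᴿ_

-ᴿ_ : ℝ → ℝ
-ᴿ x = mkℝ (λ n → ℚ.- seq x n) (neg-isCauchy x)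

_+ᴿ_ _-ᴿ_ _*ᴿ_ : ℝ → ℝ → ℝ
x +ᴿ y = mkℝ (λ n → seq x n ℚ.+ seq y n) (+-isCauchy x y)
x *ᴿ y = mkℝ (λ n → seq x n ℚ.* seq y n) (*-isCauchy x y)
x -ᴿ y = x +ᴿ (-ᴿ y)

+ᴿ-cong : ∀ {x x′ y y′} → x ≈ᴿ x′ → y ≈ᴿ y′ → x +ᴿ y ≈ᴿ x′ +ᴿ y′
+ᴿ-cong {x} {x′} {y} {y′} p q = mk≈ λ ε ε>0 →
  let N , h = both (close p _ (half>0 ε>0)) (close q _ (half>0 ε>0)) in
  N , λ n N≤n →
    subst (λ t → ∣ t ∣ ℚ.< ε) (sym (+-difference (seq x n) (seq y n) (seq x′ n) (seq y′ n)))
      (∣+∣< (seq x n ℚ.- seq x′ n) (seq y n ℚ.- seq y′ n) (proj₁ (h n N≤n)) (proj₂ (h n N≤n)))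

-ᴿ-cong : ∀ {x y} → x ≈ᴿ y → -ᴿ x ≈ᴿ -ᴿ y
-ᴿ-cong {x} {y} p = mk≈ λ ε ε>0 → let N , h = close p ε ε>0 in
  N , λ n N≤n → subst (ℚ._< ε) (neg-difference (seq x n) (seq y n)) (h n N≤n)

*ᴿ-cong : ∀ {x x′ y y′} → x ≈ᴿ x′ → y ≈ᴿ y′ → x *ᴿ y ≈ᴿ x′ *ᴿ y′
*ᴿ-cong {x} {x′} {y} {y′} p q = mk≈ λ ε ε>0 →
  let N , h = both (both (X.from , X.bounded) (Y.from , Y.bounded))
                   (both (close p _ (shrink>0 Y.B {{Y.B>0}} (half>0 ε>0)))
                         (close q _ (shrink>0 X.B {{X.B>0}} (half>0 ε>0))))
  in N , λ n N≤n →
    let (bx , by) , (px , qy) = h n N≤n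
    in subst (λ t → ∣ t ∣ ℚ.< ε) (sym (*-difference (seq x n) (seq y n) (seq x′ n) (seq y′ n)))
         (∣+∣< (seq x n ℚ.* (seq y n ℚ.- seq y′ n)) (seq y′ n ℚ.* (seq x n ℚ.- seq x′ n))
           (∣*∣< X.B {{X.B>0}} (seq x n) (seq y n ℚ.- seq y′ n) bx qy)
           (∣*∣< Y.B {{Y.B>0}} (seq y′ n) (seq x n ℚ.- seq x′ n) by px))
  where
  module X = Bound (bound x)
  module Y = Bound (bound y′)

ℝ-commutativeRing : CommutativeRing 0ℓ 0ℓ
ℝ-commutativeRing = record
  { Carrier = ℝ ; _≈_ = _≈ᴿ_ ; _+_ = _+ᴿ_ ; _*_ = _*ᴿ_ ; -_ = -ᴿ_ ; 0# = 0ᴿ ; 1# = 1ᴿ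
  ; isCommutativeRing = record
    { isRing = record
      { +-isAbelianGroup = record
        { isGroup = record
          { isMonoid = record
            { isSemigroup = record
              { isMagma = record
                { isEquivalence = record { refl = ≈ᴿ-refl ; sym = ≈ᴿ-sym ; trans = ≈ᴿ-trans }
                ; ∙-cong = +ᴿ-cong }
              ; assoc = λ x y z → pointwise λ n → ℚ.+-assoc (seq x n) (seq y n) (seq z n) }
            ; identity = (λ x → pointwise λ n → ℚ.+-identityˡ (seq x n))
                       , (λ x → pointwise λ n → ℚ.+-identityʳ (seq x n)) }
          ; inverse = (λ x → pointwise λ n → ℚ.+-inverseˡ (seq x n))
                    , (λ x → pointwise λ n → ℚ.+-inverseʳ (seq x n))
          ; ⁻¹-cong = -ᴿ-cong }
        ; comm = λ x y → pointwise λ n → ℚ.+-comm (seq x n) (seq y n) }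
      ; *-cong = *ᴿ-cong
      ; *-assoc = λ x y z → pointwise λ n → ℚ.*-assoc (seq x n) (seq y n) (seq z n)
      ; *-identity = (λ x → pointwise λ n → ℚ.*-identityˡ (seq x n))
                   , (λ x → pointwise λ n → ℚ.*-identityʳ (seq x n))
      ; distrib = (λ x y z → pointwise λ n → ℚ.*-distribˡ-+ (seq x n) (seq y n) (seq z n))
                , (λ x y z → pointwise λ n → ℚ.*-distribʳ-+ (seq x n) (seq y n) (seq z n)) }
    ; *-comm = λ x y → pointwise λ n → ℚ.*-comm (seq x n) (seq y n) } }

------------------------------------------------------------------------
-- Complex numbers

record ℂ : Set where
  constructor _+i_
  field
    re im : ℝ

open ℂ public

infix 4 _≈ᶜ_

record _≈ᶜ_ (z w : ℂ) : Set where
  constructor mk≈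
  field
    re≈ : re z ≈ᴿ re w
    im≈ : im z ≈ᴿ im w

open _≈ᶜ_ public

infix  8 -ᶜ_
infixl 7 _*ᶜ_
infixl 6 _+ᶜ_

0ᶜ 1ᶜ : ℂ
0ᶜ = 0ᴿ +i 0ᴿ
1ᶜ = 1ᴿ +i 0ᴿ

_+ᶜ_ _*ᶜ_ : ℂ → ℂ → ℂ
(a +i b) +ᶜ (c +i d) = (a +ᴿ c) +i (b +ᴿ d)
(a +i b) *ᶜ (c +i d) = (a *ᴿ c -ᴿ b *ᴿ d) +i (a *ᴿ d +ᴿ b *ᴿ c)

-ᶜ_ conj : ℂ → ℂ
-ᶜ (a +i b)   = (-ᴿ a) +i (-ᴿ b)
conj (a +i b) = a +i (-ᴿ b)

private
  module ComplexLaws (R : CommutativeRing 0ℓ 0ℓ) where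
    open CommutativeRing R renaming (refl to rfl; sym to symm; trans to _∙_)
    open import Algebra.Properties.Ring ring using (-1*x≈-x)
    open import Algebra.Solver.Ring.NaturalCoefficients.Default commutativeSemiring

    -- The semiring solver treats m = -1 as an indeterminate.
    neg : ∀ x → - x ≈ - 1# * x
    neg x = symm (-1*x≈-x x)

    sub : ∀ x y → x - y ≈ x + - 1# * y
    sub x y = +-cong rfl (neg y)

    assoc-re : ∀ a b c d e f →
      (a * c - b * d) * e - (a * d + b * c) * f ≈ a * (c * e - d * f) - b * (c * f + d * e)
    assoc-re a b c d e f =
      (+-cong (*-cong (sub _ _) rfl) (neg _)
       ∙ solve 7 (λ m a b c d e f →
           (a :* c :+ m :* (b :* d)) :* e :+ m :* ((a :* d :+ b :* c) :* f) :=
           a :* (c :* e :+ m :* (d :* f)) :+ m :* (b :* (c :* f :+ d :* e)))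
           rfl (- 1#) a b c d e f)
      ∙ symm (+-cong (*-cong rfl (sub _ _)) (neg _))

    assoc-im : ∀ a b c d e f →
      (a * c - b * d) * f + (a * d + b * c) * e ≈ a * (c * f + d * e) + b * (c * e - d * f)
    assoc-im a b c d e f =
      (+-cong (*-cong (sub _ _) rfl) rfl
       ∙ solve 7 (λ m a b c d e f →
           (a :* c :+ m :* (b :* d)) :* f :+ (a :* d :+ b :* c) :* e :=
           a :* (c :* f :+ d :* e) :+ b :* (c :* e :+ m :* (d :* f)))
           rfl (- 1#) a b c d e f)
      ∙ symm (+-cong rfl (*-cong rfl (sub _ _)))

    distˡ-re : ∀ a b c d e f →
      a * (c + e) - b * (d + f) ≈ (a * c - b * d) + (a * e - b * f)
    distˡ-re a b c d e f =
      (sub _ _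
       ∙ solve 7 (λ m a b c d e f →
           a :* (c :+ e) :+ m :* (b :* (d :+ f)) :=
           (a :* c :+ m :* (b :* d)) :+ (a :* e :+ m :* (b :* f)))
           rfl (- 1#) a b c d e f)
      ∙ symm (+-cong (sub _ _) (sub _ _))

    distˡ-im : ∀ a b c d e f →
      a * (d + f) + b * (c + e) ≈ (a * d + b * c) + (a * f + b * e)
    distˡ-im = solve 6 (λ a b c d e f →
      a :* (d :+ f) :+ b :* (c :+ e) := (a :* d :+ b :* c) :+ (a :* f :+ b :* e)) rfl

    distʳ-re : ∀ a b c d e f →
      (c + e) * a - (d + f) * b ≈ (c * a - d * b) + (e * a - f * b)
    distʳ-re a b c d e f =
      (sub _ _
       ∙ solve 7 (λ m a b c d e f →
           (c :+ e) :* a :+ m :* ((d :+ f) :* b) :=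
           (c :* a :+ m :* (d :* b)) :+ (e :* a :+ m :* (f :* b)))
           rfl (- 1#) a b c d e f)
      ∙ symm (+-cong (sub _ _) (sub _ _))

    distʳ-im : ∀ a b c d e f →
      (c + e) * b + (d + f) * a ≈ (c * b + d * a) + (e * b + f * a)
    distʳ-im = solve 6 (λ a b c d e f →
      (c :+ e) :* b :+ (d :+ f) :* a := (c :* b :+ d :* a) :+ (e :* b :+ f :* a)) rfl

    comm-re : ∀ a b c d → a * c - b * d ≈ c * a - d * b
    comm-re a b c d = +-cong (*-comm a c) (-‿cong (*-comm b d))

    comm-im : ∀ a b c d → a * d + b * c ≈ c * b + d * a
    comm-im = solve 4 (λ a b c d → a :* d :+ b :* c := c :* b :+ d :* a) rfl

ℂ-commutativeRing : CommutativeRing 0ℓ 0ℓ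
ℂ-commutativeRing = record
  { Carrier = ℂ ; _≈_ = _≈ᶜ_ ; _+_ = _+ᶜ_ ; _*_ = _*ᶜ_ ; -_ = -ᶜ_ ; 0# = 0ᶜ ; 1# = 1ᶜ
  ; isCommutativeRing = record
    { isRing = record
      { +-isAbelianGroup = record
        { isGroup = record
          { isMonoid = record
            { isSemigroup = record
              { isMagma = record
                { isEquivalence = record
                  { refl  = mk≈ ≈ᴿ-refl ≈ᴿ-refl
                  ; sym   = λ p → mk≈ (≈ᴿ-sym (re≈ p)) (≈ᴿ-sym (im≈ p))
                  ; trans = λ p q → mk≈ (≈ᴿ-trans (re≈ p) (re≈ q)) (≈ᴿ-trans (im≈ p) (im≈ q)) }
                ; ∙-cong = λ p q → mk≈ (+ᴿ-cong (re≈ p) (re≈ q)) (+ᴿ-cong (im≈ p) (im≈ q)) }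
              ; assoc = λ x y z → mk≈ (R.+-assoc (re x) (re y) (re z))
                                      (R.+-assoc (im x) (im y) (im z)) }
            ; identity = (λ x → mk≈ (R.+-identityˡ (re x)) (R.+-identityˡ (im x)))
                       , (λ x → mk≈ (R.+-identityʳ (re x)) (R.+-identityʳ (im x))) }
          ; inverse = (λ x → mk≈ (R.-‿inverseˡ (re x)) (R.-‿inverseˡ (im x)))
                    , (λ x → mk≈ (R.-‿inverseʳ (re x)) (R.-‿inverseʳ (im x)))
          ; ⁻¹-cong = λ p → mk≈ (-ᴿ-cong (re≈ p)) (-ᴿ-cong (im≈ p)) }
        ; comm = λ x y → mk≈ (R.+-comm (re x) (re y)) (R.+-comm (im x) (im y)) }
      ; *-cong = λ p q → mk≈
          (+ᴿ-cong (*ᴿ-cong (re≈ p) (re≈ q)) (-ᴿ-cong (*ᴿ-cong (im≈ p) (im≈ q))))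
          (+ᴿ-cong (*ᴿ-cong (re≈ p) (im≈ q)) (*ᴿ-cong (im≈ p) (re≈ q)))
      ; *-assoc = λ (a +i b) (c +i d) (e +i f) →
          mk≈ (L.assoc-re a b c d e f) (L.assoc-im a b c d e f)
      ; *-identity =
          (λ (a +i b) → mk≈ (pointwise λ n → 1*-re (seq a n) (seq b n))
                            (pointwise λ n → 1*-im (seq a n) (seq b n)))
        , (λ (a +i b) → mk≈ (pointwise λ n → *1-re (seq a n) (seq b n))
                            (pointwise λ n → *1-im (seq a n) (seq b n)))
      ; distrib =
          (λ (a +i b) (c +i d) (e +i f) → mk≈ (L.distˡ-re a b c d e f) (L.distˡ-im a b c d e f))
        , (λ (a +i b) (c +i d) (e +i f) → mk≈ (L.distʳ-re a b c d e f) (L.distʳ-im a b c d e f)) }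
    ; *-comm = λ (a +i b) (c +i d) → mk≈ (L.comm-re a b c d) (L.comm-im a b c d) } }
  where
  module L = ComplexLaws ℝ-commutativeRing
  module R = CommutativeRing ℝ-commutativeRing
  open +-*-Solver
  1*-re : ∀ a b → 1ℚ ℚ.* a ℚ.- 0ℚ ℚ.* b ≡ a
  1*-re = solve 2 (λ a b → con 1ℚ :* a :- con 0ℚ :* b := a) refl
  1*-im : ∀ a b → 1ℚ ℚ.* b ℚ.+ 0ℚ ℚ.* a ≡ b
  1*-im = solve 2 (λ a b → con 1ℚ :* b :+ con 0ℚ :* a := b) refl
  *1-re : ∀ a b → a ℚ.* 1ℚ ℚ.- b ℚ.* 0ℚ ≡ a
  *1-re = solve 2 (λ a b → a :* con 1ℚ :- b :* con 0ℚ := a) refl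
  *1-im : ∀ a b → a ℚ.* 0ℚ ℚ.+ b ℚ.* 1ℚ ≡ b
  *1-im = solve 2 (λ a b → a :* con 0ℚ :+ b :* con 1ℚ := b) refl

------------------------------------------------------------------------
-- Simple graphs

record SimpleGraph (V : Set) : Set₁ where
  field
    Adj    : V → V → Set
    symm   : ∀ {u v} → Adj u v → Adj v u
    irrefl : ∀ {v} → ¬ Adj v v

open SimpleGraph public

infix 4 _≃ᴳ_

_≃ᴳ_ : ∀ {V} → SimpleGraph V → SimpleGraph V → Set
G ≃ᴳ H = ∀ u v → Adj G u v ⇔ Adj H u v

-- The intended range is n ≥ 3; for smaller n the loops this would create
-- are excluded by i ≢ j.
Cycle : ∀ n .{{_ : NonZero n}} → SimpleGraph (Fin n)
Cycle n = record
  { Adj    = λ i j → i ≢ j × (toℕ j ≡ suc (toℕ i) % n ⊎ toℕ i ≡ suc (toℕ j) % n)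
  ; symm   = λ (i≢j , p) → i≢j ∘ sym , Sum.swap p
  ; irrefl = λ (i≢i , _) → i≢i refl
  }

Path : ∀ n → SimpleGraph (Fin n)
Path n = record
  { Adj    = λ i j → toℕ j ≡ suc (toℕ i) ⊎ toℕ i ≡ suc (toℕ j)
  ; symm   = Sum.swap
  ; irrefl = λ { (inj₁ p) → ℕ.1+n≢n (sym p) ; (inj₂ p) → ℕ.1+n≢n (sym p) }
  }

infixr 7 _□_

_□_ : ∀ {V₁ V₂} → SimpleGraph V₁ → SimpleGraph V₂ → SimpleGraph (V₁ × V₂)
G₁ □ G₂ = record
  { Adj    = λ (u , v) (u′ , v′) → (u ≡ u′ × Adj G₂ v v′) ⊎ (v ≡ v′ × Adj G₁ u u′)
  ; symm   = Sum.map (λ (p , e) → sym p , symm G₂ e) (λ (p , e) → sym p , symm G₁ e)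
  ; irrefl = λ { (inj₁ (_ , e)) → irrefl G₂ e ; (inj₂ (_ , e)) → irrefl G₁ e }
  }

relabel : ∀ {V W} → W ↔ V → SimpleGraph V → SimpleGraph W
relabel φ G = record
  { Adj    = λ u v → Adj G (to u) (to v)
  ; symm   = symm G
  ; irrefl = irrefl G
  }
  where open Inverse φ using (to)

------------------------------------------------------------------------
-- Matrices and minimum positive semidefinite rank

IsLeast IsGreatest : (ℕ → Set) → ℕ → Set
IsLeast    P r = P r × (∀ s → P s → r ℕ.≤ s)
IsGreatest P r = P r × (∀ s → P s → s ℕ.≤ r)

-- The data on ℝ and on ℂ needed to speak of Hermitian positive semidefinite
-- matrices; 0≤_ means "is a nonnegative real number".
record Scalars : Set₁ where
  field
    commutativeRing : CommutativeRing 0ℓ 0ℓ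
  open CommutativeRing commutativeRing public hiding (refl; sym; trans)
  open CommutativeRing commutativeRing public using ()
    renaming (refl to ≈-refl; sym to ≈-sym; trans to ≈-trans)
  field
    _⋆      : Carrier → Carrier
    ⋆-cong  : ∀ {x y} → x ≈ y → x ⋆ ≈ y ⋆
    ⋆-0#    : 0# ⋆ ≈ 0#
    0≤_     : Carrier → Set

ℝ-scalars : Scalars
ℝ-scalars = record
  { commutativeRing = ℝ-commutativeRing
  ; _⋆     = id
  ; ⋆-cong = id
  ; ⋆-0#   = ≈ᴿ-refl
  ; 0≤_    = 0ᴿ ≤ᴿ_
  }

ℂ-scalars : Scalars
ℂ-scalars = record
  { commutativeRing = ℂ-commutativeRing
  ; _⋆     = conj
  ; ⋆-cong = λ p → mk≈ (re≈ p) (-ᴿ-cong (im≈ p))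
  ; ⋆-0#   = mk≈ ≈ᴿ-refl (pointwise λ _ → refl)
  ; 0≤_    = λ z → 0ᴿ ≤ᴿ re z × im z ≈ᴿ 0ᴿ
  }

module _ (K : Scalars) where
  open Scalars K

  Matrix : ℕ → Set
  Matrix N = Fin N → Fin N → Carrier

  ∑ : ∀ {n} → Vector Carrier n → Carrier
  ∑ = sum +-rawMonoid

  Hermitian : ∀ {N} → Matrix N → Set
  Hermitian A = ∀ i j → A i j ≈ A j i ⋆

  PositiveSemidefinite : ∀ {N} → Matrix N → Set
  PositiveSemidefinite {N} A =
    ∀ (x : Vector Carrier N) → 0≤ ∑ (λ i → ∑ (λ j → x i ⋆ * A i j * x j))

  LinearlyIndependent : ∀ {r N} → (Fin r → Vector Carrier N) → Set
  LinearlyIndependent {r} v = ∀ (c : Vector Carrier r) →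
    (∀ i → ∑ (λ k → c k * v k i) ≈ 0#) → ∀ k → c k ≈ 0#

  -- The rank, as a relation: r is the largest number of linearly independent
  -- columns.  Repeated indices in f are harmless, as they yield a dependent family.
  HasRank : ∀ {N} → Matrix N → ℕ → Set
  HasRank {N} A = IsGreatest λ s →
    ∃ λ (f : Fin s → Fin N) → LinearlyIndependent (λ k i → A i (f k))

  𝒢 : ∀ {N} (A : Matrix N) → Hermitian A → SimpleGraph (Fin N)
  𝒢 A herm = record
    { Adj    = λ i j → i ≢ j × ¬ (A i j ≈ 0#)
    ; symm   = λ {i} {j} (i≢j , Aij≉0) → i≢j ∘ sym , λ Aji≈0 →
        Aij≉0 (≈-trans (herm i j) (≈-trans (⋆-cong Aji≈0) ⋆-0#))
    ; irrefl = λ (i≢i , _) → i≢i refl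
    }

  IsPSDRankOf : ∀ {N} → SimpleGraph (Fin N) → ℕ → Set
  IsPSDRankOf {N} G r = Σ (Matrix N) λ B → Σ (Hermitian B) λ herm →
    PositiveSemidefinite B × 𝒢 B herm ≃ᴳ G × HasRank B r

  -- "mr₊ of G over K equals r"
  Ismr₊ : ∀ {N} → SimpleGraph (Fin N) → ℕ → Set
  Ismr₊ G = IsLeast (IsPSDRankOf G)

{-# OPTIONS --safe #-}
module Submission where

-- Lower bound: in any Hermitian matrix with this graph, reading the linear
-- relations among columns row by row shows that a combination of columns which
-- vanishes on the first layer vanishes on every layer, so the 3n - 3 columns
-- outside the first layer are independent.
--
-- Upper bound: B = Mᵀ M, where M is rational with n - 1 block rows; block row w is
-- T = J - I on layer w, U = 2 J - 4 I on layer w + 1, and 0 elsewhere.  The link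
-- blocks of B are T U = 4 I, and its layer blocks are T² = I + J, U² = 16 I - 4 J or
-- T² + U² = 17 I - 3 J, none of which has a zero off the diagonal.  All scalars
-- needed here are rational, so the dependence of more than 3n - 3 columns follows
-- from Gaussian elimination over ℚ, where equality is decidable.

open import Defs
open import Algebra.Bundles using (CommutativeRing)
import Algebra.Properties.Semiring.Sum as SemiringSum
open import Data.Fin using (Fin; zero; suc; toℕ; combine; remQuot; inject₁; punchIn)
import Data.Fin as Fin
open import Data.Fin.Properties
  using (*↔×; any?; all?; combine-injective; combine-remQuot; remQuot-combine;
         toℕ-inject₁; toℕ-injective; punchInᵢ≢i)
open import Data.Nat using (ℕ; zero; suc; s≤s; _≤_; _<_; _*_; _∸_)
open import Data.Nat.DivMod using (_%_)
import Data.Nat as ℕ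
import Data.Nat.Properties as ℕ
open import Data.Product using (∃; _×_; _,_; proj₁; proj₂; uncurry)
open import Data.Rational as ℚ using (ℚ; 0ℚ; 1ℚ; ½; ∣_∣)
import Data.Rational.Properties as ℚ
open import Data.Rational.Solver using (module +-*-Solver)
open import Data.Sum as Sum using (_⊎_; inj₁; inj₂)
open import Data.Vec.Functional using (Vector; removeAt; insertAt)
open import Data.Vec.Functional.Properties using (insertAt-lookup; insertAt-punchIn)
open import Function using (_∘_)
open import Function.Bundles using (_⇔_; mk⇔; Equivalence)
open import Level using (0ℓ)
import Relation.Binary.Reasoning.Setoid as SetoidReasoning
open import Relation.Binary.PropositionalEquality
  using (_≡_; _≢_; refl; sym; trans; cong; cong₂; subst; subst₂; module ≡-Reasoning)
open import Relation.Nullary using (¬_; yes; no; contradiction)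
open import Relation.Nullary.Decidable
  using (¬?; _×-dec_; _⊎-dec_; _→-dec_; from-yes; decidable-stable)

private variable m : ℕ

-- Finite sums and linear algebra over ℚ

module Sums (R : CommutativeRing 0ℓ 0ℓ) where
  open CommutativeRing R using (Carrier; _≈_; 0#; semiring; +-congˡ; +-identityʳ)
    renaming (trans to ≈-trans)
  open SemiringSum semiring public

  sum-zero : ∀ {n} (t : Vector Carrier n) → (∀ i → t i ≈ 0#) → sum t ≈ 0#
  sum-zero {n} t t≈0 = ≈-trans (sum-cong-≋ t≈0) (sum-replicate-zero n)

  sum-single : ∀ {n} (t : Vector Carrier n) i → (∀ j → j ≢ i → t j ≈ 0#) → sum t ≈ t i
  sum-single {suc n} t i t≈0 = ≈-trans (sum-remove t)
    (≈-trans (+-congˡ (sum-zero (removeAt t i) λ j → t≈0 (punchIn i j) (punchInᵢ≢i i j)))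
             (+-identityʳ (t i)))

module ℚ∑ = Sums ℚ.+-*-commutativeRing

ℚ-*-nonzero : ∀ {p q} → p ≢ 0ℚ → q ≢ 0ℚ → p ℚ.* q ≢ 0ℚ
ℚ-*-nonzero {p} {q} p≢0 q≢0 pq≡0 = q≢0 (begin
  q                       ≡⟨ ℚ.*-identityˡ q ⟨
  1ℚ ℚ.* q                ≡⟨ cong (ℚ._* q) (ℚ.*-inverseˡ p) ⟨
  (ℚ.1/ p ℚ.* p) ℚ.* q    ≡⟨ ℚ.*-assoc (ℚ.1/ p) p q ⟩
  ℚ.1/ p ℚ.* (p ℚ.* q)    ≡⟨ cong (ℚ.1/ p ℚ.*_) pq≡0 ⟩
  ℚ.1/ p ℚ.* 0ℚ           ≡⟨ ℚ.*-zeroʳ (ℚ.1/ p) ⟩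
  0ℚ                      ∎)
  where
  open ≡-Reasoning
  instance _ = ℚ.≢-nonZero p≢0

-- Gaussian elimination, cross-multiplied so that no division occurs.
nontrivial-kernel : ∀ {r s} → r < s → (M : Fin r → Fin s → ℚ) →
  ∃ λ (c : Vector ℚ s) → (∃ λ k → c k ≢ 0ℚ) × (∀ i → ℚ∑.sum (λ k → c k ℚ.* M i k) ≡ 0ℚ)
nontrivial-kernel {zero}  {suc s} _ M = (λ _ → 1ℚ) , (zero , λ ()) , λ ()
nontrivial-kernel {suc r} {suc s} (s≤s r<s) M with any? (λ k → ¬? (M zero k ℚ.≟ 0ℚ))
... | no row₀≡0 =
  let c , c≢0 , Mc≡0 = nontrivial-kernel (ℕ.m<n⇒m<1+n r<s) (M ∘ suc)
  in c , c≢0 , λ where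
    zero    → ℚ∑.sum-zero (λ k → c k ℚ.* M zero k) λ k →
      trans (cong (c k ℚ.*_) (decidable-stable (M zero k ℚ.≟ 0ℚ) λ ≢0 → row₀≡0 (k , ≢0)))
            (ℚ.*-zeroʳ (c k))
    (suc i) → Mc≡0 i
... | yes (k₀ , p≢0) = c , c≢0 , Mc≡0
  where
  open ≡-Reasoning
  p = M zero k₀

  rest : Fin (suc r) → Vector ℚ s
  rest i j = M i (punchIn k₀ j)

  -- `p` times each later row minus the multiple of the first row that clears column `k₀`; these are
  -- the equations left for the remaining unknowns.
  M′ : Fin r → Fin s → ℚ
  M′ i j = p ℚ.* rest (suc i) j ℚ.- M (suc i) k₀ ℚ.* rest zero j

  solution = nontrivial-kernel r<s M′
  c′  = proj₁ solution
  j₀  = proj₁ (proj₁ (proj₂ solution))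

  S : Fin (suc r) → ℚ
  S i = ℚ∑.sum (λ j → c′ j ℚ.* rest i j)

  -- Scaling the other unknowns by `p` lets the pivot unknown be `- S zero`, so the first equation
  -- reads `p * S zero - p * S zero = 0`.
  c : Vector ℚ (suc s)
  c = insertAt (λ j → p ℚ.* c′ j) k₀ (ℚ.- S zero)

  c≢0 : ∃ λ k → c k ≢ 0ℚ
  c≢0 = punchIn k₀ j₀ , λ eq → ℚ-*-nonzero p≢0 (proj₂ (proj₁ (proj₂ solution)))
    (trans (sym (insertAt-punchIn (λ j → p ℚ.* c′ j) k₀ (ℚ.- S zero) j₀)) eq)

  eliminate : ∀ i → ℚ∑.sum (λ k → c k ℚ.* M i k) ≡ p ℚ.* S i ℚ.- M i k₀ ℚ.* S zero
  eliminate i = begin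
    ℚ∑.sum (λ k → c k ℚ.* M i k)
      ≡⟨ ℚ∑.sum-remove {i = k₀} (λ k → c k ℚ.* M i k) ⟩
    c k₀ ℚ.* M i k₀ ℚ.+ ℚ∑.sum (λ j → c (punchIn k₀ j) ℚ.* rest i j)
      ≡⟨ cong₂ (λ a b → a ℚ.* M i k₀ ℚ.+ b)
           (insertAt-lookup (λ j → p ℚ.* c′ j) k₀ (ℚ.- S zero))
           (trans (ℚ∑.sum-cong-≗ λ j → trans
                     (cong (ℚ._* rest i j) (insertAt-punchIn (λ j → p ℚ.* c′ j) k₀ (ℚ.- S zero) j))
                     (ℚ.*-assoc p (c′ j) (rest i j)))
                  (sym (ℚ∑.*-distribˡ-sum p (λ j → c′ j ℚ.* rest i j)))) ⟩
    (ℚ.- S zero) ℚ.* M i k₀ ℚ.+ p ℚ.* S i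
      ≡⟨ solve 4 (λ s m p t → (:- s) :* m :+ p :* t := p :* t :- m :* s) refl
           (S zero) (M i k₀) p (S i) ⟩
    p ℚ.* S i ℚ.- M i k₀ ℚ.* S zero ∎
    where open +-*-Solver

  Mc≡0 : ∀ i → ℚ∑.sum (λ k → c k ℚ.* M i k) ≡ 0ℚ
  Mc≡0 zero    = trans (eliminate zero) (ℚ.+-inverseʳ (p ℚ.* S zero))
  Mc≡0 (suc i) = begin
    ℚ∑.sum (λ k → c k ℚ.* M (suc i) k)
      ≡⟨ eliminate (suc i) ⟩
    p ℚ.* S (suc i) ℚ.- q ℚ.* S zero
      ≡⟨ solve 4 (λ p a q b → p :* a :- q :* b := p :* a :+ (:- q) :* b) refl p (S (suc i)) q (S zero) ⟩
    p ℚ.* S (suc i) ℚ.+ (ℚ.- q) ℚ.* S zero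
      ≡⟨ cong₂ ℚ._+_ (ℚ∑.*-distribˡ-sum p (λ j → c′ j ℚ.* rest (suc i) j))
                     (ℚ∑.*-distribˡ-sum (ℚ.- q) (λ j → c′ j ℚ.* rest zero j)) ⟩
    ℚ∑.sum (λ j → p ℚ.* (c′ j ℚ.* rest (suc i) j)) ℚ.+
    ℚ∑.sum (λ j → (ℚ.- q) ℚ.* (c′ j ℚ.* rest zero j))
      ≡⟨ ℚ∑.∑-distrib-+ (λ j → p ℚ.* (c′ j ℚ.* rest (suc i) j))
                        (λ j → (ℚ.- q) ℚ.* (c′ j ℚ.* rest zero j)) ⟨
    ℚ∑.sum (λ j → p ℚ.* (c′ j ℚ.* rest (suc i) j) ℚ.+ (ℚ.- q) ℚ.* (c′ j ℚ.* rest zero j))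
      ≡⟨ ℚ∑.sum-cong-≗ (λ j → solve 5
           (λ p c a q b → p :* (c :* a) :+ (:- q) :* (c :* b) := c :* (p :* a :- q :* b)) refl
           p (c′ j) (rest (suc i) j) q (rest zero j)) ⟩
    ℚ∑.sum (λ j → c′ j ℚ.* M′ i j)
      ≡⟨ proj₂ (proj₂ solution) i ⟩
    0ℚ ∎
    where
    open +-*-Solver
    q = M (suc i) k₀

-- Matrices over a field with involution containing ℚ

C₃□P : ∀ n → SimpleGraph (Fin (3 * n))
C₃□P n = relabel (*↔× {3} {n}) (Cycle 3 □ Path n)

-- Inverses are not needed: cancellation, together with stability of _≈ 0#, is all
-- the field structure that the triangular elimination uses.
record IsStarField (K : Scalars) : Set where
  open Scalars K hiding (zero) renaming (_*_ to _·_)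
  field
    ≈0-stable : ∀ {x} → ¬ ¬ (x ≈ 0#) → x ≈ 0#
    *-cancel0 : ∀ {a c} → ¬ (a ≈ 0#) → c · a ≈ 0# → c ≈ 0#
    ⋆-+       : ∀ x y → (x + y) ⋆ ≈ x ⋆ + y ⋆
    ⋆-*       : ∀ x y → (x · y) ⋆ ≈ x ⋆ · y ⋆
    0≤-cong   : ∀ {x y} → x ≈ y → 0≤ x → 0≤ y
    0≤-0#     : 0≤ 0#
    0≤-+      : ∀ {x y} → 0≤ x → 0≤ y → 0≤ (x + y)
    0≤-⋆*     : ∀ x → 0≤ (x ⋆ · x)
    ι         : ℚ → Carrier
    ι-0       : ι 0ℚ ≈ 0#
    ι-+       : ∀ p q → ι (p ℚ.+ q) ≈ ι p + ι q
    ι-*       : ∀ p q → ι (p ℚ.* q) ≈ ι p · ι q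
    ι-⋆       : ∀ q → ι q ⋆ ≈ ι q
    ι≈0⇒≡0    : ∀ {q} → ι q ≈ 0# → q ≡ 0ℚ

-- Lower bound: the columns outside the first layer

module LowerBound {K : Scalars} (isStarField : IsStarField K) where
  open Scalars K hiding (zero) renaming (_*_ to _·_)
  open IsStarField isStarField
  open Sums commutativeRing using (sum-single)

  -- Enumerates the vertices outside the first layer. `combine` runs through the layers fastest, so
  -- these indices do not form one contiguous block.
  nextLayer : ∀ m → Fin (3 * m) → Fin (3 * suc m)
  nextLayer m k = let u , v = remQuot {3} m k in combine u (suc v)

  nextLayer-combine : ∀ {m} (u : Fin 3) (v : Fin m) → nextLayer m (combine u v) ≡ combine u (suc v)
  nextLayer-combine u v = cong (λ (u , v) → combine u (suc v)) (remQuot-combine {3} u v)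

  -- The first layer is a zero forcing set: the row of the vertex (u , v) forces
  -- the coefficient of the column of (u , v + 1) to vanish.
  nextLayer-independent : ∀ {m} (A : Matrix K (3 * suc m)) (herm : Hermitian K A) →
    𝒢 K A herm ≃ᴳ C₃□P (suc m) →
    LinearlyIndependent K (λ (k : Fin (3 * m)) i → A i (nextLayer m k))
  nextLayer-independent {m} A herm graph c Ac≈0 k =
    subst (λ j → c j ≈ 0#) (combine-remQuot {3} m k)
      (forced _ (proj₂ (remQuot {3} m k)) ℕ.≤-refl (proj₁ (remQuot {3} m k)))
    where
    -- Strong induction on the layer, with `t` bounding `toℕ v`. In the row of `(u , v)`, terms with
    -- `v′ < v` die by induction, and those with `v′ ≥ v` have entry zero except at the pivot
    -- `(u , v + 1)`.
    forced : ∀ t (v : Fin m) → toℕ v < t → ∀ (u : Fin 3) → c (combine u v) ≈ 0#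
    forced (suc t) v (s≤s v≤t) u = *-cancel0 pivot
      (≈-trans (≈-sym (sum-single (λ k → c k · A row (nextLayer m k)) (combine u v) others)) (Ac≈0 row))
      where
      row = combine u (inject₁ v)

      pivot : ¬ (A row (nextLayer m (combine u v)) ≈ 0#)
      pivot = subst (λ j → ¬ (A row j ≈ 0#)) (sym (nextLayer-combine u v))
        (proj₂ (Equivalence.from (graph row (combine u (suc v)))
        (subst₂ (Adj (Cycle 3 □ Path (suc m)))
          (sym (remQuot-combine u (inject₁ v))) (sym (remQuot-combine u (suc v)))
          (inj₁ (refl , inj₁ (cong suc (sym (toℕ-inject₁ v))))))))

      -- The graph says nothing about the diagonal entry of the row, but that one has `v = v′ + 1`
      -- and is excluded by the hypothesis on `v′`. Refuting adjacency yields vanishing only under a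
      -- double negation.
      nonadjacent : ∀ u′ (v′ : Fin m) → ¬ (toℕ v′ < toℕ v) → combine u′ v′ ≢ combine u v →
                    ¬ ¬ (A row (combine u′ (suc v′)) ≈ 0#)
      nonadjacent u′ v′ v′≮v ≢uv ≉0 with
        subst₂ (Adj (Cycle 3 □ Path (suc m)))
          (remQuot-combine u (inject₁ v)) (remQuot-combine u′ (suc v′))
          (Equivalence.to (graph row (combine u′ (suc v′)))
            ((λ eq → v′≮v (preceding (proj₂ (combine-injective u (inject₁ v) u′ (suc v′) eq)))) , ≉0))
        where
        preceding : inject₁ v ≡ suc v′ → toℕ v′ < toℕ v
        preceding eq = ℕ.≤-reflexive (trans (sym (cong toℕ eq)) (toℕ-inject₁ v))
      -- The upward neighbour is the pivot itself; a downward or a triangle neighbour would lie in a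
      -- layer with `v′ < v`.
      ... | inj₁ (refl , inj₁ up)   = ≢uv (cong (combine u)
              (toℕ-injective (trans (ℕ.suc-injective up) (toℕ-inject₁ v))))
      ... | inj₁ (refl , inj₂ down) = v′≮v (ℕ.<-trans (ℕ.n<1+n _)
              (ℕ.≤-reflexive (trans (sym down) (toℕ-inject₁ v))))
      ... | inj₂ (eq , _)           = v′≮v
              (ℕ.≤-reflexive (trans (sym (cong toℕ eq)) (toℕ-inject₁ v)))

      others-combine : ∀ u′ (v′ : Fin m) → combine u′ v′ ≢ combine u v →
        c (combine u′ v′) · A row (nextLayer m (combine u′ v′)) ≈ 0#
      others-combine u′ v′ ≢uv with toℕ v′ ℕ.<? toℕ v
      ... | yes v′<v = ≈-trans (*-congʳ (forced t v′ (ℕ.<-≤-trans v′<v v≤t) u′)) (zeroˡ _)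
      ... | no  v′≮v = ≈-trans
        (*-congˡ (subst (λ j → A row j ≈ 0#) (sym (nextLayer-combine u′ v′))
                        (≈0-stable (nonadjacent u′ v′ v′≮v ≢uv))))
        (zeroʳ _)

      others : ∀ k → k ≢ combine u v → c k · A row (nextLayer m k) ≈ 0#
      others k = subst (λ k → k ≢ combine u v → c k · A row (nextLayer m k) ≈ 0#)
        (combine-remQuot {3} m k) (uncurry others-combine (remQuot {3} m k))

-- Gram matrices of rational matrices

module Gram {r N : ℕ} (M : Fin r → Fin N → ℚ) where

  gram : Fin N → Fin N → ℚ
  gram i j = ℚ∑.sum (λ p → M p i ℚ.* M p j)

  -- Associativity: `(Mᵀ M) c = Mᵀ (M c)`, on the columns selected by `f`.
  gram-kernel : ∀ {s} (f : Fin s → Fin N) (c : Vector ℚ s) →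
    (∀ p → ℚ∑.sum (λ k → c k ℚ.* M p (f k)) ≡ 0ℚ) →
    ∀ i → ℚ∑.sum (λ k → c k ℚ.* gram i (f k)) ≡ 0ℚ
  gram-kernel f c Mc≡0 i = begin
    ℚ∑.sum (λ k → c k ℚ.* gram i (f k))
      ≡⟨ ℚ∑.sum-cong-≗ (λ k → ℚ∑.*-distribˡ-sum (c k) (λ p → M p i ℚ.* M p (f k))) ⟩
    ℚ∑.sum (λ k → ℚ∑.sum (λ p → c k ℚ.* (M p i ℚ.* M p (f k))))
      ≡⟨ ℚ∑.∑-comm (λ k p → c k ℚ.* (M p i ℚ.* M p (f k))) ⟩
    ℚ∑.sum (λ p → ℚ∑.sum (λ k → c k ℚ.* (M p i ℚ.* M p (f k))))
      ≡⟨ ℚ∑.sum-cong-≗ (λ p → trans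
           (ℚ∑.sum-cong-≗ λ k → solve 3 (λ c a b → c :* (a :* b) := a :* (c :* b)) refl
             (c k) (M p i) (M p (f k)))
           (sym (ℚ∑.*-distribˡ-sum (M p i) (λ k → c k ℚ.* M p (f k))))) ⟩
    ℚ∑.sum (λ p → M p i ℚ.* ℚ∑.sum (λ k → c k ℚ.* M p (f k)))
      ≡⟨ ℚ∑.sum-zero (λ p → M p i ℚ.* ℚ∑.sum (λ k → c k ℚ.* M p (f k)))
           (λ p → trans (cong (M p i ℚ.*_) (Mc≡0 p)) (ℚ.*-zeroʳ (M p i))) ⟩
    0ℚ ∎
    where
    open ≡-Reasoning
    open +-*-Solver

  module _ {K : Scalars} (isStarField : IsStarField K) where
    open Scalars K hiding (zero) renaming (_*_ to _·_)
    open IsStarField isStarField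
    open Sums commutativeRing
    open SetoidReasoning setoid

    ι-sum : ∀ {n} (t : Vector ℚ n) → ι (ℚ∑.sum t) ≈ sum (ι ∘ t)
    ι-sum {zero}  t = ι-0
    ι-sum {suc n} t = ≈-trans (ι-+ _ _) (+-congˡ (ι-sum (t ∘ suc)))

    ⋆-sum : ∀ {n} (t : Vector Carrier n) → sum t ⋆ ≈ sum (λ i → t i ⋆)
    ⋆-sum {zero}  t = ⋆-0#
    ⋆-sum {suc n} t = ≈-trans (⋆-+ _ _) (+-congˡ (⋆-sum (t ∘ suc)))

    0≤-sum : ∀ {n} (t : Vector Carrier n) → (∀ i → 0≤ t i) → 0≤ sum t
    0≤-sum {zero}  t 0≤t = 0≤-0#
    0≤-sum {suc n} t 0≤t = 0≤-+ (0≤t zero) (0≤-sum (t ∘ suc) (0≤t ∘ suc))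

    ιgram : Matrix K N
    ιgram i j = ι (gram i j)

    gram-sym : ∀ i j → gram i j ≡ gram j i
    gram-sym i j = ℚ∑.sum-cong-≗ λ p → ℚ.*-comm (M p i) (M p j)

    ιgram-hermitian : Hermitian K ιgram
    ιgram-hermitian i j = ≈-trans (reflexive (cong ι (gram-sym i j))) (≈-sym (ι-⋆ (gram j i)))

    -- With `y = M x`, the form at `x` is the sum of the `y p ⋆ · y p`; the entries of `M` are
    -- rational, hence fixed by `_⋆`.
    ιgram-psd : PositiveSemidefinite K ιgram
    ιgram-psd x = 0≤-cong (≈-sym form≈) (0≤-sum (λ p → y p ⋆ · y p) λ p → 0≤-⋆* (y p))
      where
      y : Vector Carrier r
      y p = sum (λ j → ι (M p j) · x j)

      entry : ∀ i j → x i ⋆ · ιgram i j · x j ≈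
              sum (λ p → (ι (M p i) · x i) ⋆ · (ι (M p j) · x j))
      entry i j = begin
        x i ⋆ · ιgram i j · x j
          ≈⟨ *-assoc _ _ _ ⟩
        x i ⋆ · (ιgram i j · x j)
          ≈⟨ *-congˡ (*-congʳ (ι-sum λ p → M p i ℚ.* M p j)) ⟩
        x i ⋆ · (sum (λ p → ι (M p i ℚ.* M p j)) · x j)
          ≈⟨ *-congˡ (*-distribʳ-sum (x j) (λ p → ι (M p i ℚ.* M p j))) ⟩
        x i ⋆ · sum (λ p → ι (M p i ℚ.* M p j) · x j)
          ≈⟨ *-distribˡ-sum (x i ⋆) (λ p → ι (M p i ℚ.* M p j) · x j) ⟩
        sum (λ p → x i ⋆ · (ι (M p i ℚ.* M p j) · x j))
          ≈⟨ sum-cong-≋ (λ p → begin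
               x i ⋆ · (ι (M p i ℚ.* M p j) · x j)
                 ≈⟨ *-congˡ (≈-trans (*-congʳ (ι-* _ _)) (*-assoc _ _ _)) ⟩
               x i ⋆ · (ι (M p i) · (ι (M p j) · x j))
                 ≈⟨ *-assoc _ _ _ ⟨
               x i ⋆ · ι (M p i) · (ι (M p j) · x j)
                 ≈⟨ *-congʳ (≈-trans (*-comm _ _) (*-congʳ (≈-sym (ι-⋆ _)))) ⟩
               ι (M p i) ⋆ · x i ⋆ · (ι (M p j) · x j)
                 ≈⟨ *-congʳ (⋆-* _ _) ⟨
               (ι (M p i) · x i) ⋆ · (ι (M p j) · x j) ∎) ⟩
        sum (λ p → (ι (M p i) · x i) ⋆ · (ι (M p j) · x j)) ∎

      form≈ : sum (λ i → sum (λ j → x i ⋆ · ιgram i j · x j)) ≈ sum (λ p → y p ⋆ · y p)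
      form≈ = begin
        sum (λ i → sum (λ j → x i ⋆ · ιgram i j · x j))
          ≈⟨ sum-cong-≋ (λ i → sum-cong-≋ (entry i)) ⟩
        sum (λ i → sum (λ j → sum (λ p → (ι (M p i) · x i) ⋆ · (ι (M p j) · x j))))
          ≈⟨ sum-cong-≋ (λ i → ∑-comm (λ j p → (ι (M p i) · x i) ⋆ · (ι (M p j) · x j))) ⟩
        sum (λ i → sum (λ p → sum (λ j → (ι (M p i) · x i) ⋆ · (ι (M p j) · x j))))
          ≈⟨ sum-cong-≋ (λ i → sum-cong-≋ (λ p →
               *-distribˡ-sum ((ι (M p i) · x i) ⋆) (λ j → ι (M p j) · x j))) ⟨
        sum (λ i → sum (λ p → (ι (M p i) · x i) ⋆ · y p))
          ≈⟨ ∑-comm (λ i p → (ι (M p i) · x i) ⋆ · y p) ⟩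
        sum (λ p → sum (λ i → (ι (M p i) · x i) ⋆ · y p))
          ≈⟨ sum-cong-≋ (λ p → ≈-trans
               (≈-sym (*-distribʳ-sum (y p) (λ i → (ι (M p i) · x i) ⋆)))
               (*-congʳ (≈-sym (⋆-sum (λ i → ι (M p i) · x i))))) ⟩
        sum (λ p → y p ⋆ · y p) ∎

    -- If `r < s`, the selected columns of `M` satisfy a nontrivial rational relation. It passes to
    -- the Gram matrix, and `ι` carries it into the field.
    rank≤ : ∀ s → (∃ λ (f : Fin s → Fin N) → LinearlyIndependent K (λ k i → ιgram i (f k))) → s ≤ r
    rank≤ s (f , independent) = ℕ.≮⇒≥ λ r<s →
      let c , (k , ck≢0) , Mc≡0 = nontrivial-kernel r<s (λ p k → M p (f k))
      in ck≢0 (ι≈0⇒≡0 (independent (ι ∘ c) (λ i → begin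
           sum (λ k → ι (c k) · ιgram i (f k))       ≈⟨ sum-cong-≋ (λ k → ι-* (c k) (gram i (f k))) ⟨
           sum (λ k → ι (c k ℚ.* gram i (f k)))      ≈⟨ ι-sum (λ k → c k ℚ.* gram i (f k)) ⟨
           ι (ℚ∑.sum (λ k → c k ℚ.* gram i (f k)))   ≡⟨ cong ι (gram-kernel f c Mc≡0 i) ⟩
           ι 0ℚ                                      ≈⟨ ι-0 ⟩
           0#                                        ∎) k))

-- A rational factor of a matrix with graph C₃ □ Pₙ

-- `U` is four times the inverse of `T`, which makes the link blocks scalar.
T U : Fin 3 → Fin 3 → ℚ
T i j with i Fin.≟ j
... | yes _ = 0ℚ
... | no  _ = 1ℚ
U i j with i Fin.≟ j
... | yes _ = ℚ.- (1ℚ ℚ.+ 1ℚ)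
... | no  _ = 1ℚ ℚ.+ 1ℚ

topRow : Fin 3 → Fin 3 → Fin (suc (suc m)) → ℚ
topRow r u zero          = T r u
topRow r u (suc zero)    = U r u
topRow r u (suc (suc _)) = 0ℚ

-- With row index type `Fin (m * 3)`, `suc m * 3` unfolds to three rows plus `m * 3`, so the matrix
-- is defined by peeling off block rows.
factor : ∀ m → Fin (m * 3) → Fin 3 → Fin (suc m) → ℚ
factor (suc m) zero                u v       = topRow zero u v
factor (suc m) (suc zero)          u v       = topRow (suc zero) u v
factor (suc m) (suc (suc zero))    u v       = topRow (suc (suc zero)) u v
factor (suc m) (suc (suc (suc p))) u zero    = 0ℚ
factor (suc m) (suc (suc (suc p))) u (suc v) = factor m p u v

-- Block structure of the Gram matrix

prismGram : ∀ m → Fin 3 → Fin (suc m) → Fin 3 → Fin (suc m) → ℚ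
prismGram m u v u′ v′ = ℚ∑.sum (λ p → factor m p u v ℚ.* factor m p u′ v′)

dot : (a b : Fin 3 → ℚ) → ℚ
dot a b = a zero ℚ.* b zero ℚ.+
  (a (suc zero) ℚ.* b (suc zero) ℚ.+ a (suc (suc zero)) ℚ.* b (suc (suc zero)))

topDot : Fin 3 → Fin (suc (suc m)) → Fin 3 → Fin (suc (suc m)) → ℚ
topDot u v u′ v′ = dot (λ r → topRow r u v) (λ r → topRow r u′ v′)

lower : ∀ m → Fin 3 → Fin (suc (suc m)) → Fin 3 → Fin (suc (suc m)) → ℚ
lower m u v u′ v′ = ℚ∑.sum (λ (p : Fin (m * 3)) →
  factor (suc m) (suc (suc (suc p))) u v ℚ.* factor (suc m) (suc (suc (suc p))) u′ v′)

-- Drives the induction on block rows: `lower` vanishes when either layer is the first, and on two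
-- later layers it unfolds to `prismGram m` with both layers shifted down.
prismGram-suc : ∀ m u v u′ v′ →
  prismGram (suc m) u v u′ v′ ≡ topDot u v u′ v′ ℚ.+ lower m u v u′ v′
prismGram-suc m u v u′ v′ = solve 4 (λ a b c d → a :+ (b :+ (c :+ d)) := (a :+ (b :+ c)) :+ d) refl
  (topRow zero u v ℚ.* topRow zero u′ v′)
  (topRow (suc zero) u v ℚ.* topRow (suc zero) u′ v′)
  (topRow (suc (suc zero)) u v ℚ.* topRow (suc (suc zero)) u′ v′)
  (lower m u v u′ v′)
  where open +-*-Solver

lower-zeroˡ : ∀ m u u′ (v′ : Fin (suc (suc m))) → lower m u zero u′ v′ ≡ 0ℚ
lower-zeroˡ m u u′ v′ = ℚ∑.sum-zero _ λ p → ℚ.*-zeroˡ (factor (suc m) (suc (suc (suc p))) u′ v′)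

lower-zeroʳ : ∀ m u (v : Fin (suc (suc m))) u′ → lower m u v u′ zero ≡ 0ℚ
lower-zeroʳ m u v u′ = ℚ∑.sum-zero _ λ p → ℚ.*-zeroʳ (factor (suc m) (suc (suc (suc p))) u v)

dot-zeroˡ : ∀ b → dot (λ _ → 0ℚ) b ≡ 0ℚ
dot-zeroˡ b = solve 3 (λ x y z → con 0ℚ :* x :+ (con 0ℚ :* y :+ con 0ℚ :* z) := con 0ℚ) refl
  (b zero) (b (suc zero)) (b (suc (suc zero)))
  where open +-*-Solver

dot-zeroʳ : ∀ a → dot a (λ _ → 0ℚ) ≡ 0ℚ
dot-zeroʳ a = solve 3 (λ x y z → x :* con 0ℚ :+ (y :* con 0ℚ :+ z :* con 0ℚ) := con 0ℚ) refl
  (a zero) (a (suc zero)) (a (suc (suc zero)))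
  where open +-*-Solver

link : Fin 3 → Fin 3 → ℚ
link u u′ = dot (λ r → T r u) (λ r → U r u′)

link-comm : ∀ u u′ → dot (λ r → U r u) (λ r → T r u′) ≡ link u u′
link-comm = from-yes (all? λ u → all? λ u′ → dot (λ r → U r u) (λ r → T r u′) ℚ.≟ link u u′)

link-diagonal : ∀ u → link u u ≢ 0ℚ
link-diagonal = from-yes (all? λ u → ¬? (link u u ℚ.≟ 0ℚ))

link-off-diagonal : ∀ u u′ → u ≢ u′ → link u u′ ≡ 0ℚ
link-off-diagonal = from-yes (all? λ u → all? λ u′ → ¬? (u Fin.≟ u′) →-dec link u u′ ℚ.≟ 0ℚ)

both-zero : ∀ {p q x} → x ≡ p ℚ.+ q → p ≡ 0ℚ → q ≡ 0ℚ → x ≡ 0ℚ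
both-zero x≡p+q refl refl = x≡p+q

keepˡ : ∀ {p q x} → x ≡ p ℚ.+ q → q ≡ 0ℚ → x ≡ p
keepˡ {p} x≡p+q refl = trans x≡p+q (ℚ.+-identityʳ p)

keepʳ : ∀ {p q x} → x ≡ p ℚ.+ q → p ≡ 0ℚ → x ≡ q
keepʳ {q = q} x≡p+q refl = trans x≡p+q (ℚ.+-identityˡ q)

-- Couples adjacency of the layers with the value of the whole block, so that one case split settles
-- both directions of the graph comparison.
data OffLayer (v v′ : Fin (suc m)) : Set where
  linked   : Adj (Path (suc m)) v v′ → (∀ u u′ → prismGram m u v u′ v′ ≡ link u u′) → OffLayer v v′
  unlinked : ¬ Adj (Path (suc m)) v v′ → (∀ u u′ → prismGram m u v u′ v′ ≡ 0ℚ) → OffLayer v v′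

-- If the top block row contributes nothing, the block is that of the prism with the first layer
-- removed.
shift-offLayer : ∀ {v v′ : Fin (suc m)} →
  (∀ u u′ → topDot u (suc v) u′ (suc v′) ≡ 0ℚ) → OffLayer v v′ → OffLayer (suc v) (suc v′)
shift-offLayer {m} {v} {v′} top≡0 (linked adj eq) = linked (Sum.map (cong suc) (cong suc) adj)
  λ u u′ → trans (keepʳ (prismGram-suc m u (suc v) u′ (suc v′)) (top≡0 u u′)) (eq u u′)
shift-offLayer {m} {v} {v′} top≡0 (unlinked ¬adj eq) = unlinked
  (¬adj ∘ Sum.map ℕ.suc-injective ℕ.suc-injective)
  λ u u′ → trans (keepʳ (prismGram-suc m u (suc v) u′ (suc v′)) (top≡0 u u′)) (eq u u′)

-- Layers are stripped until one of the two is the first. Of two distinct later layers, one is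
-- beyond the second, where the top block row is zero, so stripping is harmless.
offLayer : ∀ (v v′ : Fin (suc m)) → v ≢ v′ → OffLayer v v′
offLayer {zero}  zero zero v≢v′ = contradiction refl v≢v′
offLayer {suc m} zero zero v≢v′ = contradiction refl v≢v′
offLayer {suc m} zero (suc zero) _ = linked (inj₁ refl) λ u u′ →
  keepˡ (prismGram-suc m u zero u′ (suc zero)) (lower-zeroˡ m u u′ (suc zero))
offLayer {suc m} (suc zero) zero _ = linked (inj₂ refl) λ u u′ →
  trans (keepˡ (prismGram-suc m u (suc zero) u′ zero) (lower-zeroʳ m u (suc zero) u′)) (link-comm u u′)
offLayer {suc m} zero (suc (suc v′)) _ = unlinked (λ { (inj₁ ()) ; (inj₂ ()) }) λ u u′ →
  both-zero (prismGram-suc m u zero u′ (suc (suc v′)))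
    (dot-zeroʳ (λ r → topRow r u (zero {n = suc m}))) (lower-zeroˡ m u u′ (suc (suc v′)))
offLayer {suc m} (suc (suc v)) zero _ = unlinked (λ { (inj₁ ()) ; (inj₂ ()) }) λ u u′ →
  both-zero (prismGram-suc m u (suc (suc v)) u′ zero)
    (dot-zeroˡ (λ r → topRow r u′ (zero {n = suc m}))) (lower-zeroʳ m u (suc (suc v)) u′)
offLayer {suc m} (suc zero) (suc zero) v≢v′ = contradiction refl v≢v′
offLayer {suc m} (suc zero) (suc (suc v′)) v≢v′ = shift-offLayer
  (λ u u′ → dot-zeroʳ (λ r → topRow r u (suc (zero {n = m})))) (offLayer zero (suc v′) (v≢v′ ∘ cong suc))
offLayer {suc m} (suc (suc v)) (suc v′) v≢v′ = shift-offLayer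
  (λ u u′ → dot-zeroˡ (λ r → topRow r u′ (suc v′))) (offLayer (suc v) v′ (v≢v′ ∘ cong suc))

T·T U·U : Fin 3 → Fin 3 → ℚ
T·T u u′ = dot (λ r → T r u) (λ r → T r u′)
U·U u u′ = dot (λ r → U r u) (λ r → U r u′)

blocks-nonzero : ∀ u u′ → u ≢ u′ →
  T·T u u′ ≢ 0ℚ × U·U u u′ ≢ 0ℚ × U·U u u′ ℚ.+ T·T u u′ ≢ 0ℚ
blocks-nonzero = from-yes (all? λ u → all? λ u′ → ¬? (u Fin.≟ u′) →-dec
  (¬? (T·T u u′ ℚ.≟ 0ℚ) ×-dec ¬? (U·U u u′ ℚ.≟ 0ℚ) ×-dec ¬? (U·U u u′ ℚ.+ T·T u u′ ℚ.≟ 0ℚ)))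

-- The first layer meets only a `T`, the last only a `U`, and an inner one the `U` of one block row
-- and the `T` of the next. With a single layer there would be no block row and the Gram matrix
-- would be zero.
sameLayer : ∀ (v : Fin (suc (suc m))) {u u′} → u ≢ u′ → prismGram (suc m) u v u′ v ≢ 0ℚ
sameLayer {m} zero {u} {u′} u≢u′ ≡0 = proj₁ (blocks-nonzero u u′ u≢u′)
  (trans (sym (keepˡ (prismGram-suc m u zero u′ zero) (lower-zeroˡ m u u′ zero))) ≡0)
sameLayer {zero} (suc zero) {u} {u′} u≢u′ ≡0 = proj₁ (proj₂ (blocks-nonzero u u′ u≢u′))
  (trans (sym (keepˡ (prismGram-suc zero u (suc zero) u′ (suc zero)) refl)) ≡0)
sameLayer {suc m} (suc zero) {u} {u′} u≢u′ ≡0 = proj₂ (proj₂ (blocks-nonzero u u′ u≢u′))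
  (trans (cong (U·U u u′ ℚ.+_) (sym (keepˡ (prismGram-suc m u zero u′ zero) (lower-zeroˡ m u u′ zero))))
         (trans (sym (prismGram-suc (suc m) u (suc zero) u′ (suc zero))) ≡0))
sameLayer {suc m} (suc (suc v)) {u} {u′} u≢u′ ≡0 = sameLayer (suc v) u≢u′
  (trans (sym (keepʳ (prismGram-suc (suc m) u (suc (suc v)) u′ (suc (suc v)))
                     (dot-zeroˡ (λ r → topRow r u′ (suc (suc v)))))) ≡0)

-- The triangle is complete, so within a layer adjacency is mere distinctness.
C₃-steps : ∀ (u u′ : Fin 3) → u ≢ u′ → toℕ u′ ≡ suc (toℕ u) % 3 ⊎ toℕ u ≡ suc (toℕ u′) % 3
C₃-steps = from-yes (all? λ (u : Fin 3) → all? λ u′ → ¬? (u Fin.≟ u′) →-dec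
  (toℕ u′ ℕ.≟ suc (toℕ u) % 3 ⊎-dec toℕ u ℕ.≟ suc (toℕ u′) % 3))

prismGram-graph : ∀ u (v : Fin (suc (suc m))) u′ v′ →
  ((u , v) ≢ (u′ , v′) × prismGram (suc m) u v u′ v′ ≢ 0ℚ) ⇔
  Adj (Cycle 3 □ Path (suc (suc m))) (u , v) (u′ , v′)
prismGram-graph {m} u v u′ v′ = mk⇔ to from
  where
  G = Cycle 3 □ Path (suc (suc m))
  to : (u , v) ≢ (u′ , v′) × prismGram (suc m) u v u′ v′ ≢ 0ℚ → Adj G (u , v) (u′ , v′)
  to (≢′ , ≢0) with v Fin.≟ v′
  ... | yes refl = inj₂ (refl , u≢u′ , C₃-steps u u′ u≢u′)
    where u≢u′ = λ u≡u′ → ≢′ (cong (_, v) u≡u′)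
  ... | no  v≢v′ with offLayer v v′ v≢v′ | u Fin.≟ u′
  ...   | unlinked _ eq | _        = contradiction (eq u u′) ≢0
  ...   | linked adj eq | yes u≡u′ = inj₁ (u≡u′ , adj)
  ...   | linked adj eq | no  u≢u′ = contradiction (trans (eq u u′) (link-off-diagonal u u′ u≢u′)) ≢0

  from : Adj G (u , v) (u′ , v′) → (u , v) ≢ (u′ , v′) × prismGram (suc m) u v u′ v′ ≢ 0ℚ
  from adj = (λ { refl → irrefl G adj }) , nonzero adj
    where
    nonzero : Adj G (u , v) (u′ , v′) → prismGram (suc m) u v u′ v′ ≢ 0ℚ
    nonzero (inj₂ (refl , u≢u′ , _)) = sameLayer v u≢u′
    nonzero (inj₁ (refl , adj)) with offLayer v v′ (λ { refl → irrefl (Path _) {v} adj })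
    ... | linked _ eq     = λ ≡0 → link-diagonal u (trans (sym (eq u u)) ≡0)
    ... | unlinked ¬adj _ = contradiction adj ¬adj

-- Combining the two bounds

-- `nextLayer-independent` serves twice: it shows that the Gram matrix attains this rank, and that
-- every competitor has at least this rank.
mr₊-C₃□P : ∀ {K} → IsStarField K → ∀ m → Ismr₊ K (C₃□P (suc (suc m))) (3 * suc m)
mr₊-C₃□P {K} isStarField m =
  (ιgram , ιgram-hermitian , ιgram-psd , graph ,
   (nextLayer (suc m) , nextLayer-independent ιgram ιgram-hermitian graph) ,
   λ s independent → ℕ.≤-trans (rank≤ s independent) (ℕ.≤-reflexive (ℕ.*-comm (suc m) 3))) ,
  λ s (A , herm , _ , graph , _ , s-greatest) →
    s-greatest _ (nextLayer (suc m) , nextLayer-independent A herm graph)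
  where
  open Scalars K using (≈-trans; reflexive)
  open IsStarField isStarField
  open LowerBound isStarField
  vertex = remQuot {3} (suc (suc m))

  rows : Fin (suc m * 3) → Fin (3 * suc (suc m)) → ℚ
  rows p = uncurry (factor (suc m) p) ∘ vertex

  ιgram           = Gram.ιgram rows isStarField
  ιgram-hermitian = Gram.ιgram-hermitian rows isStarField
  ιgram-psd       = Gram.ιgram-psd rows isStarField
  rank≤           = Gram.rank≤ rows isStarField

  vertex-injective : ∀ {i j} → vertex i ≡ vertex j → i ≡ j
  vertex-injective {i} {j} eq = trans (sym (combine-remQuot {3} (suc (suc m)) i))
    (trans (cong (uncurry combine) eq) (combine-remQuot {3} (suc (suc m)) j))

  graph : 𝒢 K ιgram ιgram-hermitian ≃ᴳ C₃□P (suc (suc m))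
  graph i j = mk⇔
    (λ (i≢j , ≉0) → Equivalence.to entries
      ((i≢j ∘ vertex-injective) , λ ≡0 → ≉0 (≈-trans (reflexive (cong ι ≡0)) ι-0)))
    (λ adj → let ≢ , ≢0 = Equivalence.from entries adj in ≢ ∘ cong vertex , ≢0 ∘ ι≈0⇒≡0)
    where entries = uncurry (uncurry prismGram-graph (vertex i)) (vertex j)

-- ℝ and ℂ

½*-positive : ∀ {ε} → 0ℚ ℚ.< ε → 0ℚ ℚ.< ½ ℚ.* ε
½*-positive {ε} 0<ε = subst (ℚ._< ½ ℚ.* ε) (ℚ.*-zeroʳ ½) (ℚ.*-monoʳ-<-pos ½ 0<ε)

½*+½* : ∀ ε → ½ ℚ.* ε ℚ.+ ½ ℚ.* ε ≡ ε
½*+½* ε = trans (sym (ℚ.*-distribʳ-+ ε ½ ½)) (ℚ.*-identityˡ ε)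

½*-< : ∀ {ε} → 0ℚ ℚ.< ε → ½ ℚ.* ε ℚ.< ε
½*-< {ε} 0<ε = subst₂ ℚ._<_ (ℚ.+-identityʳ (½ ℚ.* ε)) (½*+½* ε) (ℚ.+-monoʳ-< (½ ℚ.* ε) (½*-positive 0<ε))

square-nonneg : ∀ p → 0ℚ ℚ.≤ p ℚ.* p
square-nonneg p = subst (0ℚ ℚ.≤_) (∣p∣*∣p∣ (ℚ.∣p∣≡p∨∣p∣≡-p p))
  (ℚ.nonNegative⁻¹ (∣ p ∣ ℚ.* ∣ p ∣) {{ℚ.nonNeg*nonNeg⇒nonNeg ∣ p ∣ ∣ p ∣}})
  where
  instance _ = ℚ.∣-∣-nonNeg p
  open +-*-Solver
  ∣p∣*∣p∣ : ∣ p ∣ ≡ p ⊎ ∣ p ∣ ≡ ℚ.- p → ∣ p ∣ ℚ.* ∣ p ∣ ≡ p ℚ.* p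
  ∣p∣*∣p∣ (inj₁ eq) = cong₂ ℚ._*_ eq eq
  ∣p∣*∣p∣ (inj₂ eq) = trans (cong₂ ℚ._*_ eq eq) (solve 1 (λ p → (:- p) :* (:- p) := p :* p) refl p)

eventually-∧ : ∀ {P Q R : ℕ → Set} → (∀ {n} → P n → Q n → R n) →
               Eventually P → Eventually Q → Eventually R
eventually-∧ f (M , p) (N , q) = M ℕ.⊔ N , λ n le →
  f (p n (ℕ.m⊔n≤o⇒m≤o M N le)) (q n (ℕ.m⊔n≤o⇒n≤o M N le))

eventually-absurd : {P Q : ℕ → Set} → (∀ {n} → P n → ¬ Q n) → Eventually P → ¬ Eventually Q
eventually-absurd f (M , p) (N , q) =
  f (p (M ℕ.⊔ N) (ℕ.m≤m⊔n M N)) (q (M ℕ.⊔ N) (ℕ.m≤n⊔m M N))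

-- Vanishing and apartness of reals

-- `Apart` is a positive form of nonvanishing; its negation gives `≈ᴿ 0ᴿ` constructively.
Null Apart : ℝ → Set
Null x  = ∀ ε → 0ℚ ℚ.< ε → Eventually (λ n → ∣ seq x n ∣ ℚ.< ε)
Apart x = ∃ λ δ → 0ℚ ℚ.< δ × Eventually (λ n → δ ℚ.< ∣ seq x n ∣)

∣p-0∣ : ∀ p → ∣ p ℚ.- 0ℚ ∣ ≡ ∣ p ∣
∣p-0∣ p = cong ∣_∣ (ℚ.+-identityʳ p)

null⇒≈0 : ∀ {x} → Null x → x ≈ᴿ 0ᴿ
null⇒≈0 {x} null = mk≈ λ ε 0<ε → let N , h = null ε 0<ε in
  N , λ n N≤n → subst (ℚ._< ε) (sym (∣p-0∣ (seq x n))) (h n N≤n)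

≈0⇒null : ∀ {x} → x ≈ᴿ 0ᴿ → Null x
≈0⇒null {x} x≈0 ε 0<ε = let N , h = close x≈0 ε 0<ε in
  N , λ n N≤n → subst (ℚ._< ε) (∣p-0∣ (seq x n)) (h n N≤n)

apart⇒≉0 : ∀ {x} → Apart x → ¬ (x ≈ᴿ 0ᴿ)
apart⇒≉0 (δ , 0<δ , δ<∣x∣) x≈0 = eventually-absurd ℚ.<-asym δ<∣x∣ (≈0⇒null x≈0 δ 0<δ)

-- One decidable rational comparison suffices: beyond `N` the terms differ by less than `ε / 4`, so
-- comparing the term at `N` with `ε / 2` keeps all later ones below `ε` or above `ε / 4`.
small-or-apart : ∀ x ε → 0ℚ ℚ.< ε → Eventually (λ n → ∣ seq x n ∣ ℚ.< ε) ⊎ Apart x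
small-or-apart x ε 0<ε = decide (ℚ._<?_ ∣ s N ∣ (½ ℚ.* ε))
  where
  open ℚ.≤-Reasoning
  open +-*-Solver using (solve; _:=_; _:+_; _:-_)
  s  = seq x
  h  = ½ ℚ.* ε
  0<h = ½*-positive 0<ε
  δ  = ½ ℚ.* h
  N  = proj₁ (isCauchy x δ (½*-positive 0<h))
  near = proj₂ (isCauchy x δ (½*-positive 0<h))

  triangle : ∀ a b → ∣ a ∣ ℚ.≤ ∣ a ℚ.- b ∣ ℚ.+ ∣ b ∣
  triangle a b = begin
    ∣ a ∣                      ≡⟨ cong ∣_∣ (solve 2 (λ a b → a := (a :- b) :+ b) refl a b) ⟩
    ∣ (a ℚ.- b) ℚ.+ b ∣        ≤⟨ ℚ.∣p+q∣≤∣p∣+∣q∣ (a ℚ.- b) b ⟩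
    ∣ a ℚ.- b ∣ ℚ.+ ∣ b ∣      ∎

  decide : _ → _
  decide (yes ∣sN∣<h) = inj₁ (N , λ n N≤n → begin-strict
    ∣ s n ∣                      ≤⟨ triangle (s n) (s N) ⟩
    ∣ s n ℚ.- s N ∣ ℚ.+ ∣ s N ∣  <⟨ ℚ.+-mono-< (ℚ.<-trans (near n N N≤n ℕ.≤-refl) (½*-< 0<h)) ∣sN∣<h ⟩
    h ℚ.+ h                      ≡⟨ ½*+½* ε ⟩
    ε                            ∎)
  decide (no ∣sN∣≮h) = inj₂ (δ , ½*-positive 0<h , N , λ n N≤n → ℚ.≰⇒> λ ∣sn∣≤δ →
    ℚ.<-irrefl refl (begin-strict
    h                            ≤⟨ ℚ.≮⇒≥ ∣sN∣≮h ⟩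
    ∣ s N ∣                      ≤⟨ triangle (s N) (s n) ⟩
    ∣ s N ℚ.- s n ∣ ℚ.+ ∣ s n ∣  <⟨ ℚ.+-mono-<-≤ (near N n ℕ.≤-refl N≤n) ∣sn∣≤δ ⟩
    δ ℚ.+ δ                      ≡⟨ ½*+½* h ⟩
    h                            ∎))

¬apart⇒≈0 : ∀ {x} → ¬ Apart x → x ≈ᴿ 0ᴿ
¬apart⇒≈0 {x} ¬apart = null⇒≈0 λ ε 0<ε → small ε (small-or-apart x ε 0<ε)
  where
  small : ∀ ε → Eventually (λ n → ∣ seq x n ∣ ℚ.< ε) ⊎ Apart x → Eventually (λ n → ∣ seq x n ∣ ℚ.< ε)
  small ε (inj₁ small) = small
  small ε (inj₂ apart) = contradiction apart ¬apart

-- Vanishing is equivalent to the negation of `Apart`, and negations are stable.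
ℝ-≈0-stable : ∀ {x} → ¬ ¬ (x ≈ᴿ 0ᴿ) → x ≈ᴿ 0ᴿ
ℝ-≈0-stable ¬¬x≈0 = ¬apart⇒≈0 (¬¬x≈0 ∘ apart⇒≉0)

-- No inverse of `a` is formed. If `c` were apart from zero by `δ`, then `∣ca∣ < δ ε` would force
-- `∣a∣ < ε` for every `ε`, making `a` null.
ℝ-*-cancel0 : ∀ {a c} → ¬ (a ≈ᴿ 0ᴿ) → c *ᴿ a ≈ᴿ 0ᴿ → c ≈ᴿ 0ᴿ
ℝ-*-cancel0 {a} {c} a≉0 ca≈0 = ¬apart⇒≈0 λ (δ , 0<δ , δ<∣c∣) → a≉0 (null⇒≈0 λ ε 0<ε →
  let instance _ = ℚ.positive 0<δ
               _ = ℚ.positive 0<ε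
  in eventually-∧ (λ {n} δ<∣c∣ ∣ca∣<δε → ℚ.≰⇒> λ ε≤∣a∣ → ℚ.<-irrefl refl (begin-strict
       δ ℚ.* ε                        ≤⟨ ℚ.*-monoˡ-≤-nonNeg δ {{ℚ.pos⇒nonNeg δ}} ε≤∣a∣ ⟩
       δ ℚ.* ∣ seq a n ∣              ≤⟨ ℚ.*-monoʳ-≤-nonNeg ∣ seq a n ∣ {{ℚ.∣-∣-nonNeg (seq a n)}} (ℚ.<⇒≤ δ<∣c∣) ⟩
       ∣ seq c n ∣ ℚ.* ∣ seq a n ∣    ≡⟨ ℚ.∣p*q∣≡∣p∣*∣q∣ (seq c n) (seq a n) ⟨
       ∣ seq c n ℚ.* seq a n ∣        <⟨ ∣ca∣<δε ⟩
       δ ℚ.* ε                        ∎))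
     δ<∣c∣ (≈0⇒null ca≈0 (δ ℚ.* ε) (ℚ.positive⁻¹ (δ ℚ.* ε) {{ℚ.pos*pos⇒pos δ ε}})))
  where open ℚ.≤-Reasoning

0≤ᴿ-cong : ∀ {x y} → x ≈ᴿ y → 0ᴿ ≤ᴿ x → 0ᴿ ≤ᴿ y
0≤ᴿ-cong {x} {y} x≈y 0≤x = mk≤ λ ε 0<ε →
  eventually-∧ (λ {n} 0<x+½ε ∣x-y∣<½ε → begin-strict
      0ℚ                                                  <⟨ 0<x+½ε ⟩
      seq x n ℚ.+ ½ ℚ.* ε
        ≡⟨ solve 3 (λ x y e → x :+ e := (x :- y) :+ (y :+ e)) refl (seq x n) (seq y n) (½ ℚ.* ε) ⟩
      (seq x n ℚ.- seq y n) ℚ.+ (seq y n ℚ.+ ½ ℚ.* ε)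
        <⟨ ℚ.+-monoˡ-< (seq y n ℚ.+ ½ ℚ.* ε) (ℚ.≤-<-trans (p≤∣p∣ (seq x n ℚ.- seq y n)) ∣x-y∣<½ε) ⟩
      ½ ℚ.* ε ℚ.+ (seq y n ℚ.+ ½ ℚ.* ε)
        ≡⟨ solve 2 (λ y e → e :+ (y :+ e) := y :+ (e :+ e)) refl (seq y n) (½ ℚ.* ε) ⟩
      seq y n ℚ.+ (½ ℚ.* ε ℚ.+ ½ ℚ.* ε)                   ≡⟨ cong (seq y n ℚ.+_) (½*+½* ε) ⟩
      seq y n ℚ.+ ε                                       ∎)
    (below 0≤x (½ ℚ.* ε) (½*-positive 0<ε)) (close x≈y (½ ℚ.* ε) (½*-positive 0<ε))
  where
  open ℚ.≤-Reasoning
  open +-*-Solver using (solve; _:=_; _:+_; _:-_)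
  p≤∣p∣ : ∀ p → p ℚ.≤ ∣ p ∣
  p≤∣p∣ p with ℚ.≤-total 0ℚ p
  ... | inj₁ 0≤p = ℚ.≤-reflexive (sym (ℚ.0≤p⇒∣p∣≡p 0≤p))
  ... | inj₂ p≤0 = ℚ.≤-trans p≤0 (ℚ.0≤∣p∣ p)

nonneg⇒0≤ᴿ : ∀ {x} → (∀ n → 0ℚ ℚ.≤ seq x n) → 0ᴿ ≤ᴿ x
nonneg⇒0≤ᴿ 0≤x = mk≤ λ ε 0<ε → 0 , λ n _ → ℚ.+-mono-≤-< (0≤x n) 0<ε

0≤ᴿ-+ : ∀ {x y} → 0ᴿ ≤ᴿ x → 0ᴿ ≤ᴿ y → 0ᴿ ≤ᴿ x +ᴿ y
0≤ᴿ-+ {x} {y} 0≤x 0≤y = mk≤ λ ε 0<ε →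
  eventually-∧ (λ {n} p q → subst (0ℚ ℚ.<_)
      (trans (solve 3 (λ x y e → (x :+ e) :+ (y :+ e) := (x :+ y) :+ (e :+ e)) refl (seq x n) (seq y n) (½ ℚ.* ε))
             (cong ((seq x n ℚ.+ seq y n) ℚ.+_) (½*+½* ε)))
      (ℚ.+-mono-< p q))
    (below 0≤x (½ ℚ.* ε) (½*-positive 0<ε)) (below 0≤y (½ ℚ.* ε) (½*-positive 0<ε))
  where open +-*-Solver

-- The sequence is constant, so nullness tested at `ε = ∣q∣` would give `∣q∣ < ∣q∣`.
fromℚ≈0⇒≡0 : ∀ {q} → fromℚ q ≈ᴿ 0ᴿ → q ≡ 0ℚ
fromℚ≈0⇒≡0 {q} q≈0 = ℚ.∣p∣≡0⇒p≡0 q (ℚ.≤-antisym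
  (ℚ.≮⇒≥ λ 0<∣q∣ → let N , small = ≈0⇒null q≈0 ∣ q ∣ 0<∣q∣ in ℚ.<-irrefl refl (small N ℕ.≤-refl))
  (ℚ.0≤∣p∣ q))

ℝ-isStarField : IsStarField ℝ-scalars
ℝ-isStarField = record
  { ≈0-stable = ℝ-≈0-stable
  ; *-cancel0 = ℝ-*-cancel0
  ; ⋆-+       = λ _ _ → ≈ᴿ-refl
  ; ⋆-*       = λ _ _ → ≈ᴿ-refl
  ; 0≤-cong   = 0≤ᴿ-cong
  ; 0≤-0#     = nonneg⇒0≤ᴿ λ _ → ℚ.≤-refl
  ; 0≤-+      = 0≤ᴿ-+
  ; 0≤-⋆*     = λ x → nonneg⇒0≤ᴿ λ n → square-nonneg (seq x n)
  ; ι         = fromℚ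
  ; ι-0       = ≈ᴿ-refl
  ; ι-+       = λ _ _ → pointwise λ _ → refl
  ; ι-*       = λ _ _ → pointwise λ _ → refl
  ; ι-⋆       = λ _ → ≈ᴿ-refl
  ; ι≈0⇒≡0    = fromℚ≈0⇒≡0
  }

-- Cancellation and star structure over the complex numbers

-- If `∣x∣` stayed above `δ`, the sum would stay above `δ * δ`, against nullness at that tolerance.
sum-of-squares≈0 : ∀ {x y} → x *ᴿ x +ᴿ y *ᴿ y ≈ᴿ 0ᴿ → x ≈ᴿ 0ᴿ
sum-of-squares≈0 {x} {y} ss≈0 = ¬apart⇒≈0 λ (δ , 0<δ , δ<∣x∣) →
  let instance _ = ℚ.positive 0<δ in
  eventually-absurd (λ {n} δ<∣x∣ ∣ss∣<δδ → ℚ.<-irrefl refl (begin-strict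
      δ ℚ.* δ
        ≤⟨ ℚ.*-monoˡ-≤-nonNeg δ {{ℚ.pos⇒nonNeg δ}} (ℚ.<⇒≤ δ<∣x∣) ⟩
      δ ℚ.* ∣ seq x n ∣
        ≤⟨ ℚ.*-monoʳ-≤-nonNeg ∣ seq x n ∣ {{ℚ.∣-∣-nonNeg (seq x n)}} (ℚ.<⇒≤ δ<∣x∣) ⟩
      ∣ seq x n ∣ ℚ.* ∣ seq x n ∣
        ≡⟨ ℚ.∣p*q∣≡∣p∣*∣q∣ (seq x n) (seq x n) ⟨
      ∣ seq x n ℚ.* seq x n ∣
        ≡⟨ ℚ.0≤p⇒∣p∣≡p (square-nonneg (seq x n)) ⟩
      seq x n ℚ.* seq x n
        ≡⟨ ℚ.+-identityʳ (seq x n ℚ.* seq x n) ⟨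
      seq x n ℚ.* seq x n ℚ.+ 0ℚ
        ≤⟨ ℚ.+-monoʳ-≤ (seq x n ℚ.* seq x n) (square-nonneg (seq y n)) ⟩
      seq x n ℚ.* seq x n ℚ.+ seq y n ℚ.* seq y n
        ≡⟨ ℚ.0≤p⇒∣p∣≡p (ℚ.+-mono-≤ (square-nonneg (seq x n)) (square-nonneg (seq y n))) ⟨
      ∣ seq x n ℚ.* seq x n ℚ.+ seq y n ℚ.* seq y n ∣
        <⟨ ∣ss∣<δδ ⟩
      δ ℚ.* δ ∎))
    δ<∣x∣ (≈0⇒null ss≈0 (δ ℚ.* δ) (ℚ.positive⁻¹ (δ ℚ.* δ) {{ℚ.pos*pos⇒pos δ δ}}))
  where open ℚ.≤-Reasoning

-- Multiplying `c a = 0` by the conjugate of `a` gives `c ∣a∣² = 0`; its real and imaginary parts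
-- are real equations in which the nonzero `∣a∣²` cancels.
ℂ-*-cancel0 : ∀ {a c} → ¬ (a ≈ᶜ 0ᶜ) → c *ᶜ a ≈ᶜ 0ᶜ → c ≈ᶜ 0ᶜ
ℂ-*-cancel0 {p +i q} {x +i y} a≉0 (mk≈ re≈0 im≈0) = mk≈
  (ℝ-*-cancel0 ∣a∣²≉0 (≈ᴿ-trans
    (pointwise λ n → solve 4 (λ x y p q →
       x :* (p :* p :+ q :* q) := (x :* p :- y :* q) :* p :+ (x :* q :+ y :* p) :* q) refl
       (seq x n) (seq y n) (seq p n) (seq q n))
    (combination p q)))
  (ℝ-*-cancel0 ∣a∣²≉0 (≈ᴿ-trans
    (pointwise λ n → solve 4 (λ x y p q →
       y :* (p :* p :+ q :* q) := (x :* p :- y :* q) :* (:- q) :+ (x :* q :+ y :* p) :* p) refl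
       (seq x n) (seq y n) (seq p n) (seq q n))
    (combination (-ᴿ q) p)))
  where
  open +-*-Solver
  module R = CommutativeRing ℝ-commutativeRing

  ∣a∣²≉0 : ¬ (p *ᴿ p +ᴿ q *ᴿ q ≈ᴿ 0ᴿ)
  ∣a∣²≉0 eq = a≉0 (mk≈ (sum-of-squares≈0 eq)
    (sum-of-squares≈0 (≈ᴿ-trans (R.+-comm (q *ᴿ q) (p *ᴿ p)) eq)))

  combination : ∀ u v → (x *ᴿ p -ᴿ y *ᴿ q) *ᴿ u +ᴿ (x *ᴿ q +ᴿ y *ᴿ p) *ᴿ v ≈ᴿ 0ᴿ
  combination u v = ≈ᴿ-trans
    (+ᴿ-cong (≈ᴿ-trans (*ᴿ-cong re≈0 (≈ᴿ-refl {u})) (R.zeroˡ u))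
             (≈ᴿ-trans (*ᴿ-cong im≈0 (≈ᴿ-refl {v})) (R.zeroˡ v)))
    (R.+-identityˡ 0ᴿ)

ℂ-isStarField : IsStarField ℂ-scalars
ℂ-isStarField = record
  { ≈0-stable = λ ¬¬z≈0 → mk≈
      (ℝ-≈0-stable λ ≉0 → ¬¬z≈0 λ z≈0 → ≉0 (re≈ z≈0))
      (ℝ-≈0-stable λ ≉0 → ¬¬z≈0 λ z≈0 → ≉0 (im≈ z≈0))
  ; *-cancel0 = ℂ-*-cancel0
  ; ⋆-+       = λ z w → mk≈ ≈ᴿ-refl
      (pointwise λ n → ℚ.neg-distrib-+ (seq (im z) n) (seq (im w) n))
  ; ⋆-*       = λ (a +i b) (c +i d) → mk≈
      (pointwise λ n → solve 4 (λ a b c d →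
         a :* c :- b :* d := a :* c :- (:- b) :* (:- d)) refl
         (seq a n) (seq b n) (seq c n) (seq d n))
      (pointwise λ n → solve 4 (λ a b c d →
         :- (a :* d :+ b :* c) := a :* (:- d) :+ (:- b) :* c) refl
         (seq a n) (seq b n) (seq c n) (seq d n))
  ; 0≤-cong   = λ z≈w (0≤re , im≈0) →
      0≤ᴿ-cong (re≈ z≈w) 0≤re , ≈ᴿ-trans (≈ᴿ-sym (im≈ z≈w)) im≈0
  ; 0≤-0#     = nonneg⇒0≤ᴿ (λ _ → ℚ.≤-refl) , ≈ᴿ-refl
  ; 0≤-+      = λ (0≤x , x≈0) (0≤y , y≈0) → 0≤ᴿ-+ 0≤x 0≤y , ≈ᴿ-trans (+ᴿ-cong x≈0 y≈0) (R.+-identityˡ 0ᴿ)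
  ; 0≤-⋆*     = λ (a +i b) →
      nonneg⇒0≤ᴿ (λ n → subst (0ℚ ℚ.≤_)
        (solve 2 (λ a b → a :* a :+ b :* b := a :* a :- (:- b) :* b) refl (seq a n) (seq b n))
        (ℚ.+-mono-≤ (square-nonneg (seq a n)) (square-nonneg (seq b n)))) ,
      pointwise λ n → solve 2 (λ a b → a :* b :+ (:- b) :* a := con 0ℚ) refl (seq a n) (seq b n)
  ; ι         = λ q → fromℚ q +i 0ᴿ
  ; ι-0       = mk≈ ≈ᴿ-refl ≈ᴿ-refl
  ; ι-+       = λ _ _ → mk≈ (pointwise λ _ → refl) (pointwise λ _ → refl)
  ; ι-*       = λ p q → mk≈
      (pointwise λ _ → solve 2 (λ p q → p :* q := p :* q :- con 0ℚ :* con 0ℚ) refl p q)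
      (pointwise λ _ → solve 2 (λ p q → con 0ℚ := p :* con 0ℚ :+ con 0ℚ :* q) refl p q)
  ; ι-⋆       = λ _ → mk≈ ≈ᴿ-refl (pointwise λ _ → refl)
  ; ι≈0⇒≡0    = λ z≈0 → fromℚ≈0⇒≡0 (re≈ z≈0)
  }
  where
  open +-*-Solver
  module R = CommutativeRing ℝ-commutativeRing

corollary3p8 : (n : ℕ) → 2 ≤ n →
    Ismr₊ ℝ-scalars (relabel (*↔× {3} {n}) (Cycle 3 □ Path n)) (3 * n ∸ 3) ×
    Ismr₊ ℂ-scalars (relabel (*↔× {3} {n}) (Cycle 3 □ Path n)) (3 * n ∸ 3)
corollary3p8 (suc (suc m)) (s≤s (s≤s _)) = result ℝ-isStarField , result ℂ-isStarField
  where
  -- Here `n = m + 2`, so the truncated subtraction is exact.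
  3n∸3 : 3 * suc m ≡ 3 * suc (suc m) ∸ 3
  3n∸3 = sym (trans (cong (_∸ 3) (ℕ.*-suc 3 (suc m))) (ℕ.m+n∸m≡n 3 (3 * suc m)))

  result : ∀ {K} → IsStarField K → Ismr₊ K (C₃□P (suc (suc m))) (3 * suc (suc m) ∸ 3)
  result {K} isStarField =
    subst (Ismr₊ K (C₃□P (suc (suc m)))) 3n∸3 (mr₊-C₃□P isStarField m)
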